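{- Let $\ell$ be a prime, and let $\omega=e^{2\pi i/3}$. For each $\beta\in\mathbb{Z}$ with $\beta<\frac{\sqrt3}{2}\ell$ which is primitively represented by an element of $\mathbb{Z}[\omega]$ (that is, $\beta=a^2-ab+b^2$ for some $a,b\in\mathbb{Z}$ with $\gcd(a,b)=1$), there is a $3$-and-$1$ form of index $\ell$ whose temperament $\tau$ satisfies $\tau^2=\beta$.
   Context: A lattice in $\mathbb{R}^2\cong\mathbb{C}$ is the $\mathbb{Z}$-span of an $\mathbb{R}$-basis; $\langle\,,\rangle$ is the standard dot product. Let $\ell$ be a prime, $L$ a lattice and $M\subset L$ a sublattice of index $\ell$. The pair $(L,M)$ is a tempered perfect lattice (or form) of index $\ell$ if, after rescaling $L$ and $M$ by a common positive scalar, there exist non-empty sets $S\subset L-M$ and $S'\subset M-\{0\}$ such that, with $A(v)=\langle v,v\rangle$: (i) $A(v)=1$ for all $v\in S$; (ii) $A(v)>1$ for all $v\in L-M$ with $v\notin S$; (iii) $A(v)$ has a common value $u\geqslant 1$ for all $v\in S'$; (iv) $A(v)>u$ for all $v\in M-\{0\}$ with $v\notin S'$; (v) if $B$ is any positive definite quadratic form on $\mathbb{R}^2$ satisfying (i)--(iv) in place of $A$ with the same $S,S'$ and with common value $u'$ on $S'$, then $B=A$ and $u'=u$. The temperament is $\tau=\sqrt u$. It is called an $s$-and-$s'$ form if $S$ consists of $s$ pairs $\pm v$ and $S'$ consists of $s'$ pairs $\pm v$.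
   Formalization: The value β = 1 is excluded: there u = 1, and a 3-and-1 form would give four pairs ±v of minimal vectors in a planar lattice, which has at most three, so the claim fails for β = 1 and every prime ℓ. -}

module Defs where

open import Data.Fin using (Fin)
open import Data.Integer using (ℤ; +_)
import Data.Integer as ℤ
open import Data.Integer.GCD using (gcd)
open import Data.Nat using (ℕ)
import Data.Nat as ℕ
import Data.Nat.Properties as ℕ
open import Data.Product using (∃; ∃₂; _×_; _,_)
open import Data.Rational using (ℚ; 0ℚ; 1ℚ; ½)
import Data.Rational as ℚ
import Data.Rational.Properties as ℚ
open import Data.Rational.Solver using (module +-*-Solver)
open import Data.Sum using (_⊎_)
open import Function.Bundles using (_⇔_)
open import Relation.Binary.PropositionalEquality using (_≡_; refl; sym; trans; cong; subst)
open import Relation.Nullary using (¬_)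
open import Level using (0ℓ)
open import Relation.Unary using (Pred; _∈_; _∉_; _⊆_)

infix  8 -_ -ᵛ_
infixl 7 _*_ _·_
infixl 6 _+_ _+ᵛ_ _-ᵛ_
infix  4 _≃_ _<_ _≤_ _#_ _≈_

-- Real numbers: Cauchy sequences of rationals, as a setoid under _≃_.

IsCauchy : (ℕ → ℚ) → Set
IsCauchy x = ∀ ε → 0ℚ ℚ.< ε →
  ∃ λ N → ∀ m n → N ℕ.≤ m → N ℕ.≤ n → ℚ.∣ x m ℚ.- x n ∣ ℚ.< ε

record ℝ : Set where
  no-eta-equality
  field
    seq    : ℕ → ℚ
    cauchy : IsCauchy seq

open ℝ public

record _≃_ (x y : ℝ) : Set where
  constructor mk≃
  field
    close : ∀ ε → 0ℚ ℚ.< ε →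
      ∃ λ N → ∀ n → N ℕ.≤ n → ℚ.∣ seq x n ℚ.- seq y n ∣ ℚ.< ε

record _<_ (x y : ℝ) : Set where
  constructor mk<
  field
    gap      : ℚ
    0<gap    : 0ℚ ℚ.< gap
    from     : ℕ
    separate : ∀ n → from ℕ.≤ n → seq x n ℚ.+ gap ℚ.< seq y n

_≤_ : ℝ → ℝ → Set
x ≤ y = ¬ (y < x)

_#_ : ℝ → ℝ → Set
x # y = x < y ⊎ y < x

private
  half-pos : ∀ {ε} → 0ℚ ℚ.< ε → 0ℚ ℚ.< ½ ℚ.* ε
  half-pos {ε} 0<ε = subst (ℚ._< ½ ℚ.* ε) (ℚ.*-zeroʳ ½) (ℚ.*-monoʳ-<-pos ½ 0<ε)

  halves : ∀ ε → ½ ℚ.* ε ℚ.+ ½ ℚ.* ε ≡ ε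
  halves ε = trans (sym (ℚ.*-distribʳ-+ ε ½ ½)) (ℚ.*-identityˡ ε)

  +-cauchy : ∀ x y → IsCauchy x → IsCauchy y → IsCauchy (λ n → x n ℚ.+ y n)
  +-cauchy x y cx cy ε 0<ε with cx (½ ℚ.* ε) (half-pos 0<ε) | cy (½ ℚ.* ε) (half-pos 0<ε)
  ... | N₁ , h₁ | N₂ , h₂ = N₁ ℕ.⊔ N₂ , λ m n N≤m N≤n → begin-strict
      ℚ.∣ (x m ℚ.+ y m) ℚ.- (x n ℚ.+ y n) ∣
        ≡⟨ cong ℚ.∣_∣ (rearrange (x m) (y m) (x n) (y n)) ⟩
      ℚ.∣ (x m ℚ.- x n) ℚ.+ (y m ℚ.- y n) ∣
        ≤⟨ ℚ.∣p+q∣≤∣p∣+∣q∣ (x m ℚ.- x n) (y m ℚ.- y n) ⟩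
      ℚ.∣ x m ℚ.- x n ∣ ℚ.+ ℚ.∣ y m ℚ.- y n ∣
        <⟨ ℚ.+-mono-<
             (h₁ m n (ℕ.≤-trans (ℕ.m≤m⊔n N₁ N₂) N≤m) (ℕ.≤-trans (ℕ.m≤m⊔n N₁ N₂) N≤n))
             (h₂ m n (ℕ.≤-trans (ℕ.m≤n⊔m N₁ N₂) N≤m) (ℕ.≤-trans (ℕ.m≤n⊔m N₁ N₂) N≤n)) ⟩
      ½ ℚ.* ε ℚ.+ ½ ℚ.* ε
        ≡⟨ halves ε ⟩
      ε ∎
    where
    open ℚ.≤-Reasoning
    rearrange : ∀ a b c d → (a ℚ.+ b) ℚ.- (c ℚ.+ d) ≡ (a ℚ.- c) ℚ.+ (b ℚ.- d)
    rearrange = solve 4 (λ a b c d → (a :+ b) :- (c :+ d) := (a :- c) :+ (b :- d)) refl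
      where open +-*-Solver

  neg-cauchy : ∀ x → IsCauchy x → IsCauchy (λ n → ℚ.- x n)
  neg-cauchy x cx ε 0<ε with cx ε 0<ε
  ... | N , h = N , λ m n N≤m N≤n → subst (ℚ._< ε) (flip-sign (x m) (x n)) (h m n N≤m N≤n)
    where
    flip-sign : ∀ a b → ℚ.∣ a ℚ.- b ∣ ≡ ℚ.∣ ℚ.- a ℚ.- ℚ.- b ∣
    flip-sign a b = trans (sym (ℚ.∣-p∣≡∣p∣ (a ℚ.- b)))
      (cong ℚ.∣_∣ (solve 2 (λ a b → :- (a :- b) := :- a :- (:- b)) refl a b))
      where open +-*-Solver

  bounded : ∀ x → IsCauchy x →
    ∃ λ B → 0ℚ ℚ.< B × ∃ λ N → ∀ n → N ℕ.≤ n → ℚ.∣ x n ∣ ℚ.≤ B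
  bounded x cx with cx 1ℚ (ℚ.positive⁻¹ 1ℚ)
  ... | N , h = 1ℚ ℚ.+ ℚ.∣ x N ∣
              , ℚ.+-mono-<-≤ (ℚ.positive⁻¹ 1ℚ) (ℚ.0≤∣p∣ (x N))
              , N , λ n N≤n → begin
      ℚ.∣ x n ∣                              ≡⟨ cong ℚ.∣_∣ (split (x n) (x N)) ⟩
      ℚ.∣ (x n ℚ.- x N) ℚ.+ x N ∣            ≤⟨ ℚ.∣p+q∣≤∣p∣+∣q∣ (x n ℚ.- x N) (x N) ⟩
      ℚ.∣ x n ℚ.- x N ∣ ℚ.+ ℚ.∣ x N ∣        ≤⟨ ℚ.+-monoˡ-≤ ℚ.∣ x N ∣ (ℚ.<⇒≤ (h n N N≤n ℕ.≤-refl)) ⟩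
      1ℚ ℚ.+ ℚ.∣ x N ∣                       ∎
    where
    open ℚ.≤-Reasoning
    split : ∀ a b → a ≡ (a ℚ.- b) ℚ.+ b
    split = solve 2 (λ a b → a := (a :- b) :+ b) refl
      where open +-*-Solver

  choose-δ : ∀ a b ε → 0ℚ ℚ.< a → 0ℚ ℚ.< b → 0ℚ ℚ.< ε →
    ∃ λ δ → 0ℚ ℚ.< δ × a ℚ.* δ ℚ.+ b ℚ.* δ ≡ ε
  choose-δ a b ε 0<a 0<b 0<ε =
    divide (a ℚ.+ b) (ℚ.pos+pos⇒pos a {{ℚ.positive 0<a}} b {{ℚ.positive 0<b}}) (λ {δ} → ℚ.*-distribʳ-+ δ a b)
    where
    divide : ∀ k → ℚ.Positive k → (∀ {δ} → k ℚ.* δ ≡ a ℚ.* δ ℚ.+ b ℚ.* δ) →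
      ∃ λ δ → 0ℚ ℚ.< δ × a ℚ.* δ ℚ.+ b ℚ.* δ ≡ ε
    divide k k-pos distrib =
      r ℚ.* ε
      , subst (ℚ._< r ℚ.* ε) (ℚ.*-zeroʳ r) (ℚ.*-monoʳ-<-pos r {{ℚ.1/pos⇒pos k {{k-pos}}}} 0<ε)
      , trans (sym distrib)
          (trans (sym (ℚ.*-assoc k r ε))
            (trans (cong (ℚ._* ε) (ℚ.*-inverseʳ k {{ℚ.pos⇒nonZero k {{k-pos}}}}))
              (ℚ.*-identityˡ ε)))
      where
      r : ℚ
      r = (ℚ.1/ k) {{ℚ.pos⇒nonZero k {{k-pos}}}}

  product-bound : ∀ c δ p q → 0ℚ ℚ.< c →
    ℚ.∣ p ∣ ℚ.≤ c → ℚ.∣ q ∣ ℚ.< δ → ℚ.∣ p ℚ.* q ∣ ℚ.< c ℚ.* δ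
  product-bound c δ p q 0<c p≤c q<δ = begin-strict
    ℚ.∣ p ℚ.* q ∣            ≡⟨ ℚ.∣p*q∣≡∣p∣*∣q∣ p q ⟩
    ℚ.∣ p ∣ ℚ.* ℚ.∣ q ∣      ≤⟨ ℚ.*-monoʳ-≤-nonNeg ℚ.∣ q ∣ {{ℚ.∣-∣-nonNeg q}} p≤c ⟩
    c ℚ.* ℚ.∣ q ∣            <⟨ ℚ.*-monoʳ-<-pos c {{ℚ.positive 0<c}} q<δ ⟩
    c ℚ.* δ                  ∎
    where open ℚ.≤-Reasoning

  products-close : ∀ a b δ x y x′ y′ → 0ℚ ℚ.< a → 0ℚ ℚ.< b →
    ℚ.∣ x ∣ ℚ.≤ a → ℚ.∣ y′ ∣ ℚ.≤ b → ℚ.∣ x ℚ.- x′ ∣ ℚ.< δ → ℚ.∣ y ℚ.- y′ ∣ ℚ.< δ →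
    ℚ.∣ x ℚ.* y ℚ.- x′ ℚ.* y′ ∣ ℚ.< a ℚ.* δ ℚ.+ b ℚ.* δ
  products-close a b δ x y x′ y′ 0<a 0<b x≤a y′≤b dx dy = begin-strict
    ℚ.∣ x ℚ.* y ℚ.- x′ ℚ.* y′ ∣
      ≡⟨ cong ℚ.∣_∣ (expand x y x′ y′) ⟩
    ℚ.∣ x ℚ.* (y ℚ.- y′) ℚ.+ y′ ℚ.* (x ℚ.- x′) ∣
      ≤⟨ ℚ.∣p+q∣≤∣p∣+∣q∣ (x ℚ.* (y ℚ.- y′)) (y′ ℚ.* (x ℚ.- x′)) ⟩
    ℚ.∣ x ℚ.* (y ℚ.- y′) ∣ ℚ.+ ℚ.∣ y′ ℚ.* (x ℚ.- x′) ∣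
      <⟨ ℚ.+-mono-<
           (product-bound a δ x (y ℚ.- y′) 0<a x≤a dy)
           (product-bound b δ y′ (x ℚ.- x′) 0<b y′≤b dx) ⟩
    a ℚ.* δ ℚ.+ b ℚ.* δ ∎
    where
    open ℚ.≤-Reasoning
    expand : ∀ a b c d → a ℚ.* b ℚ.- c ℚ.* d ≡ a ℚ.* (b ℚ.- d) ℚ.+ d ℚ.* (a ℚ.- c)
    expand = solve 4 (λ a b c d → a :* b :- c :* d := a :* (b :- d) :+ d :* (a :- c)) refl
      where open +-*-Solver

  *-cauchy : ∀ x y → IsCauchy x → IsCauchy y → IsCauchy (λ n → x n ℚ.* y n)
  *-cauchy x y cx cy ε 0<ε =
    let a , 0<a , N₁ , x≤a = bounded x cx
        b , 0<b , N₂ , y≤b = bounded y cy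
        δ , 0<δ , sum≡ε    = choose-δ a b ε 0<a 0<b 0<ε
        N₃ , dx            = cx δ 0<δ
        N₄ , dy            = cy δ 0<δ
        N₁₂                = N₁ ℕ.⊔ N₂
        N₃₄                = N₃ ℕ.⊔ N₄
        N₁≤ = λ {k} (h : N₁₂ ℕ.⊔ N₃₄ ℕ.≤ k) → ℕ.m⊔n≤o⇒m≤o N₁ N₂ (ℕ.m⊔n≤o⇒m≤o N₁₂ N₃₄ h)
        N₂≤ = λ {k} (h : N₁₂ ℕ.⊔ N₃₄ ℕ.≤ k) → ℕ.m⊔n≤o⇒n≤o N₁ N₂ (ℕ.m⊔n≤o⇒m≤o N₁₂ N₃₄ h)
        N₃≤ = λ {k} (h : N₁₂ ℕ.⊔ N₃₄ ℕ.≤ k) → ℕ.m⊔n≤o⇒m≤o N₃ N₄ (ℕ.m⊔n≤o⇒n≤o N₁₂ N₃₄ h)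
        N₄≤ = λ {k} (h : N₁₂ ℕ.⊔ N₃₄ ℕ.≤ k) → ℕ.m⊔n≤o⇒n≤o N₃ N₄ (ℕ.m⊔n≤o⇒n≤o N₁₂ N₃₄ h)
    in N₁₂ ℕ.⊔ N₃₄ , λ m n N≤m N≤n →
      subst (ℚ.∣ x m ℚ.* y m ℚ.- x n ℚ.* y n ∣ ℚ.<_) sum≡ε
        (products-close a b δ (x m) (y m) (x n) (y n) 0<a 0<b
          (x≤a m (N₁≤ N≤m)) (y≤b n (N₂≤ N≤n))
          (dx m n (N₃≤ N≤m) (N₃≤ N≤n)) (dy m n (N₄≤ N≤m) (N₄≤ N≤n)))

_+_ : ℝ → ℝ → ℝ
seq    (x + y) n = seq x n ℚ.+ seq y n
cauchy (x + y)   = +-cauchy (seq x) (seq y) (cauchy x) (cauchy y)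

-_ : ℝ → ℝ
seq    (- x) n = ℚ.- seq x n
cauchy (- x)   = neg-cauchy (seq x) (cauchy x)

_*_ : ℝ → ℝ → ℝ
seq    (x * y) n = seq x n ℚ.* seq y n
cauchy (x * y)   = *-cauchy (seq x) (seq y) (cauchy x) (cauchy y)

fromℚ : ℚ → ℝ
seq    (fromℚ q) n = q
cauchy (fromℚ q) ε 0<ε =
  0 , λ _ _ _ _ → subst (λ d → ℚ.∣ d ∣ ℚ.< ε) (sym (ℚ.+-inverseʳ q)) 0<ε

fromℤ : ℤ → ℝ
fromℤ z = fromℚ (z ℚ./ 1)

fromℕ : ℕ → ℝ
fromℕ n = fromℤ (+ n)

0ℝ 1ℝ : ℝ
0ℝ = fromℚ 0ℚ
1ℝ = fromℚ 1ℚ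

IsSqrt : ℝ → ℝ → Set
IsSqrt s x = 0ℝ ≤ s × s * s ≃ x

ℝ² : Set
ℝ² = ℝ × ℝ

_≈_ : ℝ² → ℝ² → Set
(x , y) ≈ (x′ , y′) = x ≃ x′ × y ≃ y′

0ᵛ : ℝ²
0ᵛ = 0ℝ , 0ℝ

_+ᵛ_ : ℝ² → ℝ² → ℝ²
(x , y) +ᵛ (x′ , y′) = x + x′ , y + y′

-ᵛ_ : ℝ² → ℝ²
-ᵛ (x , y) = - x , - y

_-ᵛ_ : ℝ² → ℝ² → ℝ²
v -ᵛ w = v +ᵛ (-ᵛ w)

_·_ : ℝ → ℝ² → ℝ²
c · (x , y) = c * x , c * y

⟨_,_⟩ : ℝ² → ℝ² → ℝ
⟨ (x , y) , (x′ , y′) ⟩ = x * x′ + y * y′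

Subset : Set₁
Subset = Pred ℝ² 0ℓ

-- Membership must not depend on the Cauchy sequences representing a vector.
Extensional : Subset → Set
Extensional X = ∀ {v w} → v ≈ w → v ∈ X → w ∈ X

record IsBasis (e₁ e₂ : ℝ²) : Set where
  field
    spanning    : ∀ v → ∃₂ λ a b → v ≈ a · e₁ +ᵛ b · e₂
    independent : ∀ a b → a · e₁ +ᵛ b · e₂ ≈ 0ᵛ → a ≃ 0ℝ × b ≃ 0ℝ

ℤ-span : ℝ² → ℝ² → Subset
ℤ-span e₁ e₂ v = ∃₂ λ m n → v ≈ fromℤ m · e₁ +ᵛ fromℤ n · e₂

IsLattice : Subset → Set
IsLattice L = ∃₂ λ e₁ e₂ → IsBasis e₁ e₂ × (∀ v → v ∈ L ⇔ v ∈ ℤ-span e₁ e₂)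

-- [L : M] = k, via a complete irredundant system of k coset representatives.
record HasIndex (L M : Subset) (k : ℕ) : Set where
  field
    rep         : Fin k → ℝ²
    rep∈L       : ∀ i → rep i ∈ L
    complete    : ∀ v → v ∈ L → ∃ λ i → v -ᵛ rep i ∈ M
    irredundant : ∀ i j → rep i -ᵛ rep j ∈ M → i ≡ j

scale : ℝ → Subset → Subset
scale c X v = ∃ λ w → w ∈ X × v ≈ c · w

record QuadraticForm : Set where
  constructor form
  field
    xx xy yy : ℝ

_⟦_⟧ : QuadraticForm → ℝ² → ℝ
form p q r ⟦ x , y ⟧ = p * (x * x) + q * (x * y) + r * (y * y)

-- Non-vanishing of a real vector is apartness from 0: with ¬ (v ≈ 0ᵛ) instead,
-- positive definiteness of the dot product would amount to Markov's principle.
PositiveDefinite : QuadraticForm → Set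
PositiveDefinite B = ∀ x y → x # 0ℝ ⊎ y # 0ℝ → 0ℝ < B ⟦ x , y ⟧

-- S and S′ are exactly the minimal vectors of Q on L - M and on M - {0},
-- with minima 1 and u ≥ 1. Used for Q = A and for its competitors B.
record Conditions (L M S S′ : Subset) (Q : ℝ² → ℝ) (u : ℝ) : Set where
  field
    on-S    : ∀ v → v ∈ S → Q v ≃ 1ℝ
    off-S   : ∀ v → v ∈ L → v ∉ M → v ∉ S → 1ℝ < Q v
    1≤u     : 1ℝ ≤ u
    on-S′   : ∀ v → v ∈ S′ → Q v ≃ u
    off-S′  : ∀ v → v ∈ M → ¬ (v ≈ 0ᵛ) → v ∉ S′ → u < Q v

A : ℝ² → ℝ
A v = ⟨ v , v ⟩

-- The pair (L, M) is the rescaled one here; TemperedPerfect supplies the scalar.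
record IsPerfectFor (L M S S′ : Subset) (u : ℝ) : Set where
  field
    S-ext       : Extensional S
    S⊆L-M       : ∀ v → v ∈ S → v ∈ L × v ∉ M
    S-nonempty  : ∃ λ v → v ∈ S
    S′-ext      : Extensional S′
    S′⊆M-0      : ∀ v → v ∈ S′ → v ∈ M × ¬ (v ≈ 0ᵛ)
    S′-nonempty : ∃ λ v → v ∈ S′
    conditions  : Conditions L M S S′ A u
    perfect     : ∀ B u′ → PositiveDefinite B → Conditions L M S S′ (B ⟦_⟧) u′ →
                  (∀ v → B ⟦ v ⟧ ≃ A v) × u′ ≃ u

record TemperedPerfect (ℓ : ℕ) (L M : Subset) : Set₁ where
  field
    L-lattice : IsLattice L
    M-lattice : IsLattice M
    M⊆L       : M ⊆ L
    index     : HasIndex L M ℓ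
    c         : ℝ
    0<c       : 0ℝ < c
    S S′      : Subset
    u         : ℝ
    isPerfect : IsPerfectFor (scale c L) (scale c M) S S′ u

-- X consists of exactly k pairs ±v. A pair {v, -v} has v ≠ -v as soon as
-- v ≠ 0, which holds for all elements of the sets S and S′ above.
record ConsistsOfPairs (k : ℕ) (X : Subset) : Set where
  field
    vec      : Fin k → ℝ²
    members  : ∀ v → v ∈ X ⇔ (∃ λ i → v ≈ vec i ⊎ v ≈ -ᵛ vec i)
    distinct : ∀ i j → vec i ≈ vec j ⊎ vec i ≈ -ᵛ vec j → i ≡ j

_-and-_ : ∀ {ℓ L M} → ℕ → ℕ → TemperedPerfect ℓ L M → Set
(s -and- s′) T = ConsistsOfPairs s (TemperedPerfect.S T) × ConsistsOfPairs s′ (TemperedPerfect.S′ T)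

IsTemperament : ∀ {ℓ L M} → TemperedPerfect ℓ L M → ℝ → Set
IsTemperament T τ = IsSqrt τ (TemperedPerfect.u T)

PrimitivelyRepresented : ℤ → Set
PrimitivelyRepresented β =
  ∃₂ λ a b → gcd a b ≡ + 1 × β ≡ a ℤ.* a ℤ.- a ℤ.* b ℤ.+ b ℤ.* b

{-# OPTIONS --safe #-}

-- Let x = (a, b) be the given element of ℤ[ω] of norm β, complete it to a basis (x, y)
-- of L = ℤ[ω], and put M = ℤx + ℤℓy. The minimal vectors of L are the six units; none is
-- in M, and being three pairs they determine a quadratic form, hence perfection. A vector
-- of M not on the line of x has determinant a nonzero multiple of ℓ with x, so by
-- 4 N(x) N(z) ≥ 3 det(x, z)² its norm is at least 3ℓ²/(4β), which exceeds β exactly when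
-- β < (√3/2) ℓ. Thus ±x are the only minimal vectors of M.
module Submission where

open import Algebra.Bundles using (CommutativeRing)
import Algebra.Solver.Ring as RingSolver
open import Algebra.Solver.Ring.AlmostCommutativeRing using (_-Raw-AlmostCommutative⟶_; fromCommutativeRing)
open import Data.Fin using (Fin; zero; suc; toℕ; fromℕ<)
import Data.Fin.Properties as Fin
open import Data.Integer using (ℤ; +_)
import Data.Integer as ℤ
import Data.Integer.DivMod as ℤ
open import Data.Integer.GCD using (gcd)
import Data.Integer.Properties as ℤ
import Data.Integer.Tactic.RingSolver as ℤ
import Data.Maybe as Maybe
open import Data.Nat using (ℕ)
import Data.Nat as ℕ
import Data.Nat.GCD as ℕ
open import Data.Nat.Primality using (Prime; ¬prime[0])
import Data.Nat.Properties as ℕ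
import Data.Nat.Tactic.RingSolver as ℕ
open import Data.Product using (Σ; ∃; ∃₂; _×_; _,_; proj₁; proj₂)
open import Data.Rational using (ℚ; 0ℚ; 1ℚ; ½)
import Data.Rational as ℚ
import Data.Rational.Properties as ℚ
open import Data.Rational.Solver using (module +-*-Solver)
import Data.Rational.Unnormalised as ℚᵘ
import Data.Rational.Unnormalised.Properties as ℚᵘ
open import Data.Sum using (_⊎_; inj₁; inj₂)
open import Function.Base using (id)
open import Function.Bundles using (mk⇔)
open import Level using (0ℓ)
open import Relation.Binary.Bundles using (Setoid)
open import Relation.Binary.PropositionalEquality using (_≡_; _≢_; refl; sym; trans; cong; cong₂; subst; subst₂; module ≡-Reasoning)
open import Relation.Nullary using (¬_; yes; no; contradiction)
open import Relation.Nullary.Decidable using (dec⇒maybe)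
open import Relation.Unary using (_∈_; _∉_)
open import Defs

-- Arithmetic and order of the reals

-- Neither equality nor order of the reals is decidable, and a strict inequality carries a positive
-- rational gap; yet the conditions off `S` and `S′` demand such an inequality from the mere fact
-- that a vector is not in a set. Every question about lattice vectors is therefore moved to integer
-- coordinates, where norms are compared by cases. Reals remain in the vectors themselves, in the
-- competing forms `B`, in the temperament, and in the hypothesis on β, which is squared once into
-- the integer inequality `4β² < 3ℓ²`. The assumption `β ≢ 1` keeps `x` from being a unit: for a
-- unit the pair `±x` would lie in `M`, and at most two pairs of units would be left in `L − M`.
-- Since the minimum of ℤ[ω] is already 1, the scalar is 1. Dividing by `√3` is multiplying by
-- `√3/3`, so the relation `√3 * √3 ≃ 3` replaces any construction of real inverses.

Null : (ℕ → ℚ) → Set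
Null z = ∀ ε → 0ℚ ℚ.< ε → ∃ λ N → ∀ n → N ℕ.≤ n → ℚ.∣ z n ∣ ℚ.< ε

Bounded : (ℕ → ℚ) → Set
Bounded x = ∃ λ B → 0ℚ ℚ.< B × ∃ λ N → ∀ n → N ℕ.≤ n → ℚ.∣ x n ∣ ℚ.≤ B

null-cong : ∀ {y z} → (∀ n → y n ≡ z n) → Null y → Null z
null-cong y≡z null ε 0<ε with null ε 0<ε
... | N , h = N , λ n N≤n → subst (λ d → ℚ.∣ d ∣ ℚ.< ε) (y≡z n) (h n N≤n)

null-0 : Null (λ _ → 0ℚ)
null-0 ε 0<ε = 0 , λ _ _ → 0<ε

null-neg : ∀ {z} → Null z → Null (λ n → ℚ.- z n)
null-neg {z} null ε 0<ε with null ε 0<ε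
... | N , h = N , λ n N≤n → subst (ℚ._< ε) (sym (ℚ.∣-p∣≡∣p∣ (z n))) (h n N≤n)

neg-difference : ∀ p q → ℚ.- (p ℚ.- q) ≡ q ℚ.- p
neg-difference = solve 2 (λ p q → :- (p :- q) := q :- p) refl
  where open +-*-Solver

p+[q-p]≡q : ∀ p q → p ℚ.+ (q ℚ.- p) ≡ q
p+[q-p]≡q = solve 2 (λ p q → p :+ (q :- p) := q) refl
  where open +-*-Solver

halves : ∀ ε → ½ ℚ.* ε ℚ.+ ½ ℚ.* ε ≡ ε
halves ε = trans (sym (ℚ.*-distribʳ-+ ε ½ ½)) (ℚ.*-identityˡ ε)

half-pos : ∀ {ε} → 0ℚ ℚ.< ε → 0ℚ ℚ.< ½ ℚ.* ε
half-pos {ε} 0<ε = subst (ℚ._< ½ ℚ.* ε) (ℚ.*-zeroʳ ½) (ℚ.*-monoʳ-<-pos ½ 0<ε)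

null-+ : ∀ {y z} → Null y → Null z → Null (λ n → y n ℚ.+ z n)
null-+ {y} {z} nully nullz ε 0<ε with nully (½ ℚ.* ε) (half-pos 0<ε) | nullz (½ ℚ.* ε) (half-pos 0<ε)
... | N₁ , h₁ | N₂ , h₂ = N₁ ℕ.⊔ N₂ , λ n N≤n → begin-strict
    ℚ.∣ y n ℚ.+ z n ∣          ≤⟨ ℚ.∣p+q∣≤∣p∣+∣q∣ (y n) (z n) ⟩
    ℚ.∣ y n ∣ ℚ.+ ℚ.∣ z n ∣    <⟨ ℚ.+-mono-< (h₁ n (ℕ.m⊔n≤o⇒m≤o N₁ N₂ N≤n)) (h₂ n (ℕ.m⊔n≤o⇒n≤o N₁ N₂ N≤n)) ⟩
    ½ ℚ.* ε ℚ.+ ½ ℚ.* ε        ≡⟨ halves ε ⟩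
    ε                          ∎
  where open ℚ.≤-Reasoning

quotient : ∀ b ε → 0ℚ ℚ.< b → 0ℚ ℚ.< ε → ∃ λ δ → 0ℚ ℚ.< δ × b ℚ.* δ ≡ ε
quotient b ε 0<b 0<ε = 1/b ℚ.* ε
    , subst (ℚ._< 1/b ℚ.* ε) (ℚ.*-zeroʳ 1/b) (ℚ.*-monoʳ-<-pos 1/b {{ℚ.1/pos⇒pos b {{b-pos}}}} 0<ε)
    , trans (sym (ℚ.*-assoc b 1/b ε))
        (trans (cong (ℚ._* ε) (ℚ.*-inverseʳ b {{ℚ.pos⇒nonZero b {{b-pos}}}})) (ℚ.*-identityˡ ε))
  where
  b-pos : ℚ.Positive b
  b-pos = ℚ.positive 0<b
  1/b : ℚ
  1/b = (ℚ.1/ b) {{ℚ.pos⇒nonZero b {{b-pos}}}}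

null-* : ∀ {x z} → Bounded x → Null z → Null (λ n → x n ℚ.* z n)
null-* {x} {z} (B , 0<B , N₁ , x≤B) null ε 0<ε with quotient B ε 0<B 0<ε
... | δ , 0<δ , Bδ≡ε with null δ 0<δ
... | N₂ , z<δ = N₁ ℕ.⊔ N₂ , λ n N≤n → begin-strict
    ℚ.∣ x n ℚ.* z n ∣            ≡⟨ ℚ.∣p*q∣≡∣p∣*∣q∣ (x n) (z n) ⟩
    ℚ.∣ x n ∣ ℚ.* ℚ.∣ z n ∣      ≤⟨ ℚ.*-monoʳ-≤-nonNeg ℚ.∣ z n ∣ {{ℚ.∣-∣-nonNeg (z n)}} (x≤B n (ℕ.m⊔n≤o⇒m≤o N₁ N₂ N≤n)) ⟩
    B ℚ.* ℚ.∣ z n ∣              <⟨ ℚ.*-monoʳ-<-pos B {{ℚ.positive 0<B}} (z<δ n (ℕ.m⊔n≤o⇒n≤o N₁ N₂ N≤n)) ⟩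
    B ℚ.* δ                      ≡⟨ Bδ≡ε ⟩
    ε                            ∎
  where open ℚ.≤-Reasoning

cauchy⇒bounded : ∀ x → IsCauchy x → Bounded x
cauchy⇒bounded x cx with cx 1ℚ (ℚ.positive⁻¹ 1ℚ)
... | N , h = 1ℚ ℚ.+ ℚ.∣ x N ∣
            , ℚ.+-mono-<-≤ (ℚ.positive⁻¹ 1ℚ) (ℚ.0≤∣p∣ (x N))
            , N , λ n N≤n → begin
    ℚ.∣ x n ∣                              ≡⟨ cong ℚ.∣_∣ (split (x n) (x N)) ⟩
    ℚ.∣ (x n ℚ.- x N) ℚ.+ x N ∣            ≤⟨ ℚ.∣p+q∣≤∣p∣+∣q∣ (x n ℚ.- x N) (x N) ⟩
    ℚ.∣ x n ℚ.- x N ∣ ℚ.+ ℚ.∣ x N ∣        ≤⟨ ℚ.+-monoˡ-≤ ℚ.∣ x N ∣ (ℚ.<⇒≤ (h n N N≤n ℕ.≤-refl)) ⟩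
    1ℚ ℚ.+ ℚ.∣ x N ∣                       ∎
  where
  open ℚ.≤-Reasoning
  split : ∀ a b → a ≡ (a ℚ.- b) ℚ.+ b
  split = solve 2 (λ a b → a := (a :- b) :+ b) refl
    where open +-*-Solver

-- Real operations act term by term, so each ring axiom for ℝ follows from the same axiom for ℚ at
-- every index; only the congruences need an estimate.
pointwise : ∀ {x y} → (∀ n → seq x n ≡ seq y n) → x ≃ y
pointwise {x} {y} x≡y = mk≃ (null-cong (λ n → sym (p≡q⇒p-q≡0 (x≡y n))) null-0)
  where
  p≡q⇒p-q≡0 : ∀ {p q} → p ≡ q → p ℚ.- q ≡ 0ℚ
  p≡q⇒p-q≡0 {p} refl = ℚ.+-inverseʳ p

difference-null : ∀ {x y} → x ≃ y → Null (λ n → seq x n ℚ.- seq y n)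
difference-null = _≃_.close

≃-refl : ∀ {x} → x ≃ x
≃-refl = pointwise λ _ → refl

≃-sym : ∀ {x y} → x ≃ y → y ≃ x
≃-sym {x} {y} x≃y = mk≃ (null-cong (λ n → neg-difference (seq x n) (seq y n)) (null-neg (difference-null x≃y)))

≃-trans : ∀ {x y z} → x ≃ y → y ≃ z → x ≃ z
≃-trans {x} {y} {z} x≃y y≃z =
  mk≃ (null-cong (λ n → telescope (seq x n) (seq y n) (seq z n)) (null-+ (difference-null x≃y) (difference-null y≃z)))
  where
  telescope : ∀ a b c → (a ℚ.- b) ℚ.+ (b ℚ.- c) ≡ a ℚ.- c
  telescope = solve 3 (λ a b c → (a :- b) :+ (b :- c) := a :- c) refl
    where open +-*-Solver

+-cong : ∀ {x x′ y y′} → x ≃ x′ → y ≃ y′ → x + y ≃ x′ + y′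
+-cong {x} {x′} {y} {y′} x≃x′ y≃y′ =
  mk≃ (null-cong (λ n → rearrange (seq x n) (seq x′ n) (seq y n) (seq y′ n))
    (null-+ (difference-null x≃x′) (difference-null y≃y′)))
  where
  rearrange : ∀ a b c d → (a ℚ.- b) ℚ.+ (c ℚ.- d) ≡ (a ℚ.+ c) ℚ.- (b ℚ.+ d)
  rearrange = solve 4 (λ a b c d → (a :- b) :+ (c :- d) := (a :+ c) :- (b :+ d)) refl
    where open +-*-Solver

-‿cong : ∀ {x y} → x ≃ y → - x ≃ - y
-‿cong {x} {y} x≃y = mk≃ (null-cong (λ n → negate (seq x n) (seq y n)) (null-neg (difference-null x≃y)))
  where
  negate : ∀ a b → ℚ.- (a ℚ.- b) ≡ ℚ.- a ℚ.- (ℚ.- b)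
  negate = solve 2 (λ a b → :- (a :- b) := :- a :- (:- b)) refl
    where open +-*-Solver

*-cong : ∀ {x x′ y y′} → x ≃ x′ → y ≃ y′ → x * y ≃ x′ * y′
*-cong {x} {x′} {y} {y′} x≃x′ y≃y′ =
  mk≃ (null-cong (λ n → rearrange (seq x n) (seq x′ n) (seq y n) (seq y′ n))
    (null-+ (null-* (cauchy⇒bounded (seq x) (cauchy x)) (difference-null y≃y′))
            (null-* (cauchy⇒bounded (seq y′) (cauchy y′)) (difference-null x≃x′))))
  where
  rearrange : ∀ a b c d → a ℚ.* (c ℚ.- d) ℚ.+ d ℚ.* (a ℚ.- b) ≡ a ℚ.* c ℚ.- b ℚ.* d
  rearrange = solve 4 (λ a b c d → a :* (c :- d) :+ d :* (a :- b) := a :* c :- b :* d) refl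
    where open +-*-Solver

ℝ-commutativeRing : CommutativeRing 0ℓ 0ℓ
ℝ-commutativeRing = record
  { Carrier = ℝ ; _≈_ = _≃_ ; _+_ = _+_ ; _*_ = _*_ ; -_ = -_ ; 0# = 0ℝ ; 1# = 1ℝ
  ; isCommutativeRing = record
    { isRing = record
      { +-isAbelianGroup = record
        { isGroup = record
          { isMonoid = record
            { isSemigroup = record
              { isMagma = record
                { isEquivalence = record { refl = ≃-refl ; sym = ≃-sym ; trans = ≃-trans }
                ; ∙-cong = +-cong }
              ; assoc = λ x y z → pointwise λ n → ℚ.+-assoc (seq x n) (seq y n) (seq z n) }
            ; identity = (λ x → pointwise λ n → ℚ.+-identityˡ (seq x n))
                       , (λ x → pointwise λ n → ℚ.+-identityʳ (seq x n)) }
          ; inverse = (λ x → pointwise λ n → ℚ.+-inverseˡ (seq x n))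
                    , (λ x → pointwise λ n → ℚ.+-inverseʳ (seq x n))
          ; ⁻¹-cong = -‿cong }
        ; comm = λ x y → pointwise λ n → ℚ.+-comm (seq x n) (seq y n) }
      ; *-cong = *-cong
      ; *-assoc = λ x y z → pointwise λ n → ℚ.*-assoc (seq x n) (seq y n) (seq z n)
      ; *-identity = (λ x → pointwise λ n → ℚ.*-identityˡ (seq x n))
                   , (λ x → pointwise λ n → ℚ.*-identityʳ (seq x n))
      ; distrib = (λ x y z → pointwise λ n → ℚ.*-distribˡ-+ (seq x n) (seq y n) (seq z n))
                , (λ x y z → pointwise λ n → ℚ.*-distribʳ-+ (seq x n) (seq y n) (seq z n)) }
    ; *-comm = λ x y → pointwise λ n → ℚ.*-comm (seq x n) (seq y n) } }

ℝ-setoid : Setoid 0ℓ 0ℓ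
ℝ-setoid = CommutativeRing.setoid ℝ-commutativeRing

-- Normalisation needs coefficients whose equality can be decided. Taking them in ℚ lets constants
-- such as 1/3 be simplified inside real identities.
fromℚ-homomorphism : CommutativeRing.rawRing ℚ.+-*-commutativeRing -Raw-AlmostCommutative⟶ fromCommutativeRing ℝ-commutativeRing
fromℚ-homomorphism = record
  { ⟦_⟧    = fromℚ
  ; +-homo = λ _ _ → pointwise λ _ → refl
  ; *-homo = λ _ _ → pointwise λ _ → refl
  ; -‿homo = λ _ → pointwise λ _ → refl
  ; 0-homo = ≃-refl
  ; 1-homo = ≃-refl
  }

module ℝ-Solver = RingSolver _ _ fromℚ-homomorphism
  (λ p q → Maybe.map (λ p≡q → pointwise λ _ → p≡q) (dec⇒maybe (p ℚ.≟ q)))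

p≤∣p∣ : ∀ p → p ℚ.≤ ℚ.∣ p ∣
p≤∣p∣ p with ℚ.≤-total 0ℚ p
... | inj₁ 0≤p = ℚ.≤-reflexive (sym (ℚ.0≤p⇒∣p∣≡p 0≤p))
... | inj₂ p≤0 = ℚ.≤-trans p≤0 (ℚ.0≤∣p∣ p)

-- Half of the gap pays for the total displacement of the two ends and the other half survives. This
-- makes `<` independent of the representing sequences.
perturb-< : ∀ a a′ b b′ g → a ℚ.+ g ℚ.< b → ℚ.∣ (a′ ℚ.- a) ℚ.+ (b ℚ.- b′) ∣ ℚ.< ½ ℚ.* g → a′ ℚ.+ ½ ℚ.* g ℚ.< b′
perturb-< a a′ b b′ g a+g<b e<½g = begin-strict
    a′ ℚ.+ ½ ℚ.* g                                   ≡⟨ rearrange a a′ b b′ (½ ℚ.* g) ⟩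
    (a ℚ.+ ½ ℚ.* g ℚ.+ (b′ ℚ.- b)) ℚ.+ e             <⟨ ℚ.+-monoʳ-< (a ℚ.+ ½ ℚ.* g ℚ.+ (b′ ℚ.- b)) (ℚ.≤-<-trans (p≤∣p∣ e) e<½g) ⟩
    (a ℚ.+ ½ ℚ.* g ℚ.+ (b′ ℚ.- b)) ℚ.+ ½ ℚ.* g       ≡⟨ collect a b b′ (½ ℚ.* g) ⟩
    (a ℚ.+ (½ ℚ.* g ℚ.+ ½ ℚ.* g)) ℚ.+ (b′ ℚ.- b)     ≡⟨ cong (λ h → (a ℚ.+ h) ℚ.+ (b′ ℚ.- b)) (halves g) ⟩
    (a ℚ.+ g) ℚ.+ (b′ ℚ.- b)                         <⟨ ℚ.+-monoˡ-< (b′ ℚ.- b) a+g<b ⟩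
    b ℚ.+ (b′ ℚ.- b)                                 ≡⟨ p+[q-p]≡q b b′ ⟩
    b′                                               ∎
  where
  open ℚ.≤-Reasoning
  open +-*-Solver
  e : ℚ
  e = (a′ ℚ.- a) ℚ.+ (b ℚ.- b′)
  rearrange : ∀ a a′ b b′ h → a′ ℚ.+ h ≡ (a ℚ.+ h ℚ.+ (b′ ℚ.- b)) ℚ.+ ((a′ ℚ.- a) ℚ.+ (b ℚ.- b′))
  rearrange = solve 5 (λ a a′ b b′ h → a′ :+ h := (a :+ h :+ (b′ :- b)) :+ ((a′ :- a) :+ (b :- b′))) refl
  collect : ∀ a b b′ h → (a ℚ.+ h ℚ.+ (b′ ℚ.- b)) ℚ.+ h ≡ (a ℚ.+ (h ℚ.+ h)) ℚ.+ (b′ ℚ.- b)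
  collect = solve 4 (λ a b b′ h → (a :+ h :+ (b′ :- b)) :+ h := (a :+ (h :+ h)) :+ (b′ :- b)) refl

<-resp-≃ : ∀ {x x′ y y′} → x ≃ x′ → y ≃ y′ → x < y → x′ < y′
<-resp-≃ {x} {x′} {y} {y′} x≃x′ y≃y′ (mk< g 0<g N₁ x+g<y) =
  let N₂ , small = null-+ (difference-null (≃-sym x≃x′)) (difference-null y≃y′) (½ ℚ.* g) (half-pos 0<g)
  in mk< (½ ℚ.* g) (half-pos 0<g) (N₁ ℕ.⊔ N₂) λ n N≤n →
    perturb-< (seq x n) (seq x′ n) (seq y n) (seq y′ n) g
      (x+g<y n (ℕ.m⊔n≤o⇒m≤o N₁ N₂ N≤n)) (small n (ℕ.m⊔n≤o⇒n≤o N₁ N₂ N≤n))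

fromℚ-mono-< : ∀ {p q} → p ℚ.< q → fromℚ p < fromℚ q
fromℚ-mono-< {p} {q} p<q with ℚ.<-dense p<q
-- The gap `q − p` would only give `p + gap = q`; an intermediate point leaves the strict inequality
-- that `<` requires.
... | r , p<r , r<q = mk< (r ℚ.- p)
    (subst (ℚ._< r ℚ.- p) (ℚ.+-inverseʳ p) (ℚ.+-monoˡ-< (ℚ.- p) p<r))
    0 λ _ _ → subst (ℚ._< q) (sym (p+[q-p]≡q p r)) r<q

p<p+q : ∀ p {q} → 0ℚ ℚ.< q → p ℚ.< p ℚ.+ q
p<p+q p {q} 0<q = subst (ℚ._< p ℚ.+ q) (ℚ.+-identityʳ p) (ℚ.+-monoʳ-< p 0<q)

fromℚ-cancel-< : ∀ {p q} → fromℚ p < fromℚ q → p ℚ.< q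
fromℚ-cancel-< {p} (mk< g 0<g N p+g<q) = ℚ.<-trans (p<p+q p 0<g) (p+g<q N ℕ.≤-refl)

fromℚ-mono-≤ : ∀ {p q} → p ℚ.≤ q → fromℚ p ≤ fromℚ q
fromℚ-mono-≤ p≤q q<p = ℚ.<-irrefl refl (ℚ.<-≤-trans (fromℚ-cancel-< q<p) p≤q)

-- The new gap is `g²`, because the cross term in `(p + g)²` is nonnegative. Squaring is what
-- removes `√3` from the hypothesis on β.
fromℚ-square-< : ∀ {p y} → 0ℚ ℚ.≤ p → fromℚ p < y → fromℚ (p ℚ.* p) < y * y
fromℚ-square-< {p} {y} 0≤p (mk< g 0<g N p+g<y) = mk< (g ℚ.* g) (*-pos 0<g 0<g) N λ n N≤n → begin-strict
    p ℚ.* p ℚ.+ g ℚ.* g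
      ≤⟨ ℚ.+-mono-≤ (ℚ.*-monoʳ-≤-nonNeg p {{ℚ.nonNegative 0≤p}} p≤p+g) (ℚ.*-monoʳ-≤-nonNeg g {{ℚ.nonNegative (ℚ.<⇒≤ 0<g)}} g≤p+g) ⟩
    (p ℚ.+ g) ℚ.* p ℚ.+ (p ℚ.+ g) ℚ.* g
      ≡⟨ ℚ.*-distribˡ-+ (p ℚ.+ g) p g ⟨
    (p ℚ.+ g) ℚ.* (p ℚ.+ g)
      <⟨ ℚ.*-monoʳ-<-pos (p ℚ.+ g) {{ℚ.positive 0<p+g}} (p+g<y n N≤n) ⟩
    (p ℚ.+ g) ℚ.* seq y n
      <⟨ ℚ.*-monoˡ-<-pos (seq y n) {{ℚ.positive (ℚ.<-trans 0<p+g (p+g<y n N≤n))}} (p+g<y n N≤n) ⟩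
    seq y n ℚ.* seq y n ∎
  where
  open ℚ.≤-Reasoning
  *-pos : ∀ {a b} → 0ℚ ℚ.< a → 0ℚ ℚ.< b → 0ℚ ℚ.< a ℚ.* b
  *-pos {a} {b} 0<a 0<b = subst (ℚ._< a ℚ.* b) (ℚ.*-zeroʳ a) (ℚ.*-monoʳ-<-pos a {{ℚ.positive 0<a}} 0<b)
  p≤p+g : p ℚ.≤ p ℚ.+ g
  p≤p+g = ℚ.<⇒≤ (p<p+q p 0<g)
  g≤p+g : g ℚ.≤ p ℚ.+ g
  g≤p+g = subst (ℚ._≤ p ℚ.+ g) (ℚ.+-identityˡ g) (ℚ.+-monoˡ-≤ g 0≤p)
  0<p+g : 0ℚ ℚ.< p ℚ.+ g
  0<p+g = ℚ.+-mono-≤-< 0≤p 0<g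

-- The integers inside the rationals and the reals.

toℚᵘ-/1 : ∀ m → ℚ.toℚᵘ (m ℚ./ 1) ℚᵘ.≃ ℚᵘ.mkℚᵘ m 0
toℚᵘ-/1 m = ℚ.toℚᵘ-fromℚᵘ (ℚᵘ.mkℚᵘ m 0)

-- The quotient `m / 1` is normalised by a gcd and does not compute for a variable `m`. This law and
-- its companions are therefore checked among unnormalised rationals, where it is a plain fraction.
/1-+ : ∀ m n → (m ℤ.+ n) ℚ./ 1 ≡ m ℚ./ 1 ℚ.+ n ℚ./ 1
/1-+ m n = ℚ.toℚᵘ-injective (begin
  ℚ.toℚᵘ ((m ℤ.+ n) ℚ./ 1)                     ≈⟨ toℚᵘ-/1 (m ℤ.+ n) ⟩
  ℚᵘ.mkℚᵘ (m ℤ.+ n) 0                          ≡⟨ cong₂ (λ i j → ℚᵘ.mkℚᵘ (i ℤ.+ j) 0) (ℤ.*-identityʳ m) (ℤ.*-identityʳ n) ⟨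
  ℚᵘ.mkℚᵘ m 0 ℚᵘ.+ ℚᵘ.mkℚᵘ n 0                 ≈⟨ ℚᵘ.+-cong (toℚᵘ-/1 m) (toℚᵘ-/1 n) ⟨
  ℚ.toℚᵘ (m ℚ./ 1) ℚᵘ.+ ℚ.toℚᵘ (n ℚ./ 1)       ≈⟨ ℚ.toℚᵘ-homo-+ (m ℚ./ 1) (n ℚ./ 1) ⟨
  ℚ.toℚᵘ (m ℚ./ 1 ℚ.+ n ℚ./ 1)                 ∎)
  where open import Relation.Binary.Reasoning.Setoid ℚᵘ.≃-setoid

/1-* : ∀ m n → (m ℤ.* n) ℚ./ 1 ≡ m ℚ./ 1 ℚ.* (n ℚ./ 1)
/1-* m n = ℚ.toℚᵘ-injective (begin
  ℚ.toℚᵘ ((m ℤ.* n) ℚ./ 1)                     ≈⟨ toℚᵘ-/1 (m ℤ.* n) ⟩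
  ℚᵘ.mkℚᵘ m 0 ℚᵘ.* ℚᵘ.mkℚᵘ n 0                 ≈⟨ ℚᵘ.*-cong (toℚᵘ-/1 m) (toℚᵘ-/1 n) ⟨
  ℚ.toℚᵘ (m ℚ./ 1) ℚᵘ.* ℚ.toℚᵘ (n ℚ./ 1)       ≈⟨ ℚ.toℚᵘ-homo-* (m ℚ./ 1) (n ℚ./ 1) ⟨
  ℚ.toℚᵘ (m ℚ./ 1 ℚ.* (n ℚ./ 1))               ∎)
  where open import Relation.Binary.Reasoning.Setoid ℚᵘ.≃-setoid

/1-mono-< : ∀ {m n} → m ℤ.< n → m ℚ./ 1 ℚ.< n ℚ./ 1
/1-mono-< {m} {n} m<n = ℚ.toℚᵘ-cancel-< (begin-strict
  ℚ.toℚᵘ (m ℚ./ 1)    ≃⟨ toℚᵘ-/1 m ⟩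
  ℚᵘ.mkℚᵘ m 0         <⟨ ℚᵘ.*<* (subst₂ ℤ._<_ (sym (ℤ.*-identityʳ m)) (sym (ℤ.*-identityʳ n)) m<n) ⟩
  ℚᵘ.mkℚᵘ n 0         ≃⟨ toℚᵘ-/1 n ⟨
  ℚ.toℚᵘ (n ℚ./ 1)    ∎)
  where open ℚᵘ.≤-Reasoning

/1-mono-≤ : ∀ {m n} → m ℤ.≤ n → m ℚ./ 1 ℚ.≤ n ℚ./ 1
/1-mono-≤ {m} {n} m≤n = ℚ.toℚᵘ-cancel-≤ (begin
  ℚ.toℚᵘ (m ℚ./ 1)    ≃⟨ toℚᵘ-/1 m ⟩
  ℚᵘ.mkℚᵘ m 0         ≤⟨ ℚᵘ.*≤* (subst₂ ℤ._≤_ (sym (ℤ.*-identityʳ m)) (sym (ℤ.*-identityʳ n)) m≤n) ⟩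
  ℚᵘ.mkℚᵘ n 0         ≃⟨ toℚᵘ-/1 n ⟨
  ℚ.toℚᵘ (n ℚ./ 1)    ∎)
  where open ℚᵘ.≤-Reasoning

fromℤ-+ : ∀ m n → fromℤ (m ℤ.+ n) ≃ fromℤ m + fromℤ n
fromℤ-+ m n = pointwise λ _ → /1-+ m n

fromℤ-* : ∀ m n → fromℤ (m ℤ.* n) ≃ fromℤ m * fromℤ n
fromℤ-* m n = pointwise λ _ → /1-* m n

fromℤ-neg : ∀ m → fromℤ (ℤ.- m) ≃ - fromℤ m
fromℤ-neg m = begin
  fromℤ (ℤ.- m)                            ≈⟨ isolate (fromℤ (ℤ.- m)) (fromℤ m) ⟩
  (fromℤ (ℤ.- m) + fromℤ m) + - fromℤ m    ≈⟨ +-cong (fromℤ-+ (ℤ.- m) m) ≃-refl ⟨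
  fromℤ (ℤ.- m ℤ.+ m) + - fromℤ m          ≡⟨ cong (λ k → fromℤ k + - fromℤ m) (ℤ.+-inverseˡ m) ⟩
  0ℝ + - fromℤ m                           ≈⟨ pointwise (λ n → ℚ.+-identityˡ _) ⟩
  - fromℤ m                                ∎
  where
  open import Relation.Binary.Reasoning.Setoid ℝ-setoid
  isolate : ∀ x y → x ≃ (x + y) + - y
  isolate = solve 2 (λ x y → x := (x :+ y) :+ :- y) ≃-refl
    where open ℝ-Solver

fromℤ-mono-< : ∀ {m n} → m ℤ.< n → fromℤ m < fromℤ n
fromℤ-mono-< m<n = fromℚ-mono-< (/1-mono-< m<n)

fromℤ-mono-≤ : ∀ {m n} → m ℤ.≤ n → fromℤ m ≤ fromℤ n
fromℤ-mono-≤ m≤n = fromℚ-mono-≤ (/1-mono-≤ m≤n)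

fromℤ-cancel-< : ∀ {m n} → fromℤ m < fromℤ n → m ℤ.< n
fromℤ-cancel-< m<n = ℤ.≰⇒> λ n≤m → fromℤ-mono-≤ n≤m m<n

-- A strict inequality between `m` and `n` would survive replacing `m` by the equal real `n` and
-- give `n < n`; both orders being refuted, antisymmetry on ℤ concludes.
fromℤ-injective : ∀ {m n} → fromℤ m ≃ fromℤ n → m ≡ n
fromℤ-injective {m} {n} m≃n = ℤ.≤-antisym
  (ℤ.≮⇒≥ λ n<m → ℤ.<-irrefl refl (fromℤ-cancel-< {n} {n} (<-resp-≃ ≃-refl m≃n (fromℤ-mono-< n<m))))
  (ℤ.≮⇒≥ λ m<n → ℤ.<-irrefl refl (fromℤ-cancel-< {n} {n} (<-resp-≃ m≃n ≃-refl (fromℤ-mono-< m<n))))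

-- Square roots of natural numbers

isqrt : ∀ k → ∃ λ p → p ℕ.* p ℕ.≤ k × k ℕ.< ℕ.suc p ℕ.* ℕ.suc p
isqrt ℕ.zero = 0 , ℕ.z≤n , ℕ.s≤s ℕ.z≤n
isqrt (ℕ.suc k) with isqrt k
... | p , p²≤k , k<[1+p]² with ℕ.suc k ℕ.<? ℕ.suc p ℕ.* ℕ.suc p
... | yes 1+k<[1+p]² = p , ℕ.m≤n⇒m≤1+n p²≤k , 1+k<[1+p]²
-- The old bound `k < (1 + p)²` says `1 + k ≤ (1 + p)²`, so `1 + k` is still below the next square.
... | no  1+k≮[1+p]² = ℕ.suc p , ℕ.≮⇒≥ 1+k≮[1+p]² ,
    ℕ.≤-<-trans k<[1+p]² (ℕ.*-mono-< (ℕ.n<1+n (ℕ.suc p)) (ℕ.n<1+n (ℕ.suc p)))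

1/1+ : ℕ → ℚ
1/1+ n = + 1 ℚ./ ℕ.suc n

toℚᵘ-1/1+ : ∀ n → ℚ.toℚᵘ (1/1+ n) ℚᵘ.≃ ℚᵘ.mkℚᵘ (+ 1) n
toℚᵘ-1/1+ n = ℚ.toℚᵘ-fromℚᵘ (ℚᵘ.mkℚᵘ (+ 1) n)

0<1/1+ : ∀ n → 0ℚ ℚ.< 1/1+ n
0<1/1+ n = ℚ.toℚᵘ-cancel-< (ℚᵘ.<-respʳ-≃ (ℚᵘ.≃-sym (toℚᵘ-1/1+ n)) (ℚᵘ.positive⁻¹ (ℚᵘ.mkℚᵘ (+ 1) n)))

1+*1/1+ : ∀ n → (+ ℕ.suc n) ℚ./ 1 ℚ.* 1/1+ n ≡ 1ℚ
1+*1/1+ n = ℚ.toℚᵘ-injective (begin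
  ℚ.toℚᵘ ((+ ℕ.suc n) ℚ./ 1 ℚ.* 1/1+ n)                ≈⟨ ℚ.toℚᵘ-homo-* ((+ ℕ.suc n) ℚ./ 1) (1/1+ n) ⟩
  ℚ.toℚᵘ ((+ ℕ.suc n) ℚ./ 1) ℚᵘ.* ℚ.toℚᵘ (1/1+ n)      ≈⟨ ℚᵘ.*-cong (toℚᵘ-/1 (+ ℕ.suc n)) (toℚᵘ-1/1+ n) ⟩
  ℚᵘ.mkℚᵘ (+ ℕ.suc n) 0 ℚᵘ.* ℚᵘ.mkℚᵘ (+ 1) n           ≈⟨ ℚᵘ.*≡* (cong (λ k → + ℕ.suc k) (arith n)) ⟩
  ℚᵘ.1ℚᵘ                                               ∎)
  where
  open import Relation.Binary.Reasoning.Setoid ℚᵘ.≃-setoid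
  arith : ∀ n → n ℕ.* 1 ℕ.* 1 ≡ n ℕ.+ 0 ℕ.+ 0
  arith = ℕ.solve-∀

1/1+-null : Null 1/1+
1/1+-null (ℚ.mkℚ (+ ℕ.zero) q _) (ℚ.*<* (ℤ.+<+ ()))
1/1+-null (ℚ.mkℚ ℤ.-[1+ p ] q _) (ℚ.*<* ())
-- The field `q` is the denominator less one, so `ε ≥ 1/(q + 1) > 1/(n + 1)` as soon as `n > q`.
1/1+-null ε@(ℚ.mkℚ ℤ.+[1+ p ] q _) 0<ε = ℕ.suc q , λ n q<n →
  subst (ℚ._< ε) (sym (ℚ.0≤p⇒∣p∣≡p (ℚ.<⇒≤ (0<1/1+ n))))
    (ℚ.toℚᵘ-cancel-< (ℚᵘ.<-respˡ-≃ (ℚᵘ.≃-sym (toℚᵘ-1/1+ n)) (ℚᵘ.*<* (ℤ.+<+ (begin-strict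
      1 ℕ.* ℕ.suc q            ≡⟨ ℕ.*-identityˡ (ℕ.suc q) ⟩
      ℕ.suc q                  <⟨ ℕ.s≤s q<n ⟩
      ℕ.suc n                  ≤⟨ ℕ.m≤m+n (ℕ.suc n) (p ℕ.* ℕ.suc n) ⟩
      ℕ.suc p ℕ.* ℕ.suc n      ∎)))))
  where open ℕ.≤-Reasoning

-- This is `x ≤ √q < x + δ`, squared so as not to mention the root that is yet to be constructed.
SqrtApproximation : ℚ → ℚ → Set
SqrtApproximation q δ = ∃ λ x → 0ℚ ℚ.≤ x × x ℚ.* x ℚ.≤ q × q ℚ.< (x ℚ.+ δ) ℚ.* (x ℚ.+ δ)

square-cancel-< : ∀ {x y} → 0ℚ ℚ.≤ x → 0ℚ ℚ.≤ y → x ℚ.* x ℚ.< y ℚ.* y → x ℚ.< y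
square-cancel-< {x} {y} 0≤x 0≤y x²<y² = ℚ.≰⇒> λ y≤x → ℚ.<-irrefl refl (ℚ.<-≤-trans x²<y²
  (ℚ.≤-trans (ℚ.*-monoʳ-≤-nonNeg y {{ℚ.nonNegative 0≤y}} y≤x) (ℚ.*-monoˡ-≤-nonNeg x {{ℚ.nonNegative 0≤x}} y≤x)))

-- With `N = n + 1`, the approximation is the integer square root of `kN²` divided by `N`; dividing
-- the two inequalities of `isqrt` by `N²` gives the required ones.
sqrt-approximation : ∀ k n → SqrtApproximation ((+ k) ℚ./ 1) (1/1+ n)
sqrt-approximation k n with isqrt (k ℕ.* (ℕ.suc n ℕ.* ℕ.suc n))
... | p , p²≤kN² , kN²<[1+p]² = ι p ℚ.* δ , 0≤x , x²≤q , q<[x+δ]²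
  where
  open ℚ.≤-Reasoning
  ι : ℕ → ℚ
  ι m = (+ m) ℚ./ 1
  δ : ℚ
  δ = 1/1+ n
  δ-pos : ℚ.Positive δ
  δ-pos = ℚ.positive (0<1/1+ n)
  δ²-pos : ℚ.Positive (δ ℚ.* δ)
  δ²-pos = ℚ.pos*pos⇒pos δ {{δ-pos}} δ {{δ-pos}}
  ι-* : ∀ i j → ι (i ℕ.* j) ≡ ι i ℚ.* ι j
  ι-* i j = trans (cong (ℚ._/ 1) (ℤ.pos-* i j)) (/1-* (+ i) (+ j))
  square-scaled : ∀ m → (ι m ℚ.* δ) ℚ.* (ι m ℚ.* δ) ≡ ι (m ℕ.* m) ℚ.* (δ ℚ.* δ)
  square-scaled m = trans (regroup (ι m) δ) (cong (ℚ._* (δ ℚ.* δ)) (sym (ι-* m m)))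
    where
    regroup : ∀ a d → (a ℚ.* d) ℚ.* (a ℚ.* d) ≡ (a ℚ.* a) ℚ.* (d ℚ.* d)
    regroup = solve 2 (λ a d → (a :* d) :* (a :* d) := (a :* a) :* (d :* d)) refl
      where open +-*-Solver
  q-scaled : ι k ≡ ι (k ℕ.* (ℕ.suc n ℕ.* ℕ.suc n)) ℚ.* (δ ℚ.* δ)
  q-scaled = begin-equality
    ι k                                                        ≡⟨ ℚ.*-identityʳ (ι k) ⟨
    ι k ℚ.* 1ℚ                                                 ≡⟨ cong (λ r → ι k ℚ.* (r ℚ.* r)) (1+*1/1+ n) ⟨
    ι k ℚ.* ((ι (ℕ.suc n) ℚ.* δ) ℚ.* (ι (ℕ.suc n) ℚ.* δ))      ≡⟨ cong (ι k ℚ.*_) (square-scaled (ℕ.suc n)) ⟩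
    ι k ℚ.* (ι (ℕ.suc n ℕ.* ℕ.suc n) ℚ.* (δ ℚ.* δ))            ≡⟨ ℚ.*-assoc (ι k) (ι (ℕ.suc n ℕ.* ℕ.suc n)) (δ ℚ.* δ) ⟨
    ι k ℚ.* ι (ℕ.suc n ℕ.* ℕ.suc n) ℚ.* (δ ℚ.* δ)              ≡⟨ cong (ℚ._* (δ ℚ.* δ)) (ι-* k (ℕ.suc n ℕ.* ℕ.suc n)) ⟨
    ι (k ℕ.* (ℕ.suc n ℕ.* ℕ.suc n)) ℚ.* (δ ℚ.* δ)              ∎
  [1+p]δ : ι (ℕ.suc p) ℚ.* δ ≡ ι p ℚ.* δ ℚ.+ δ
  [1+p]δ = begin-equality
    ι (ℕ.suc p) ℚ.* δ             ≡⟨ cong (ℚ._* δ) (/1-+ (+ 1) (+ p)) ⟩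
    (1ℚ ℚ.+ ι p) ℚ.* δ            ≡⟨ expand (ι p) δ ⟩
    ι p ℚ.* δ ℚ.+ δ               ∎
    where
    expand : ∀ a d → (1ℚ ℚ.+ a) ℚ.* d ≡ a ℚ.* d ℚ.+ d
    expand = solve 2 (λ a d → (con 1ℚ :+ a) :* d := a :* d :+ d) refl
      where open +-*-Solver
  0≤x : 0ℚ ℚ.≤ ι p ℚ.* δ
  0≤x = subst (ℚ._≤ ι p ℚ.* δ) (ℚ.*-zeroˡ δ)
    (ℚ.*-monoʳ-≤-nonNeg δ {{ℚ.pos⇒nonNeg δ {{δ-pos}}}} (/1-mono-≤ {+ 0} {+ p} (ℤ.+≤+ ℕ.z≤n)))
  x²≤q : (ι p ℚ.* δ) ℚ.* (ι p ℚ.* δ) ℚ.≤ ι k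
  x²≤q = begin
    (ι p ℚ.* δ) ℚ.* (ι p ℚ.* δ)                        ≡⟨ square-scaled p ⟩
    ι (p ℕ.* p) ℚ.* (δ ℚ.* δ)                          ≤⟨ ℚ.*-monoʳ-≤-nonNeg (δ ℚ.* δ) {{ℚ.pos⇒nonNeg (δ ℚ.* δ) {{δ²-pos}}}} (/1-mono-≤ (ℤ.+≤+ p²≤kN²)) ⟩
    ι (k ℕ.* (ℕ.suc n ℕ.* ℕ.suc n)) ℚ.* (δ ℚ.* δ)      ≡⟨ q-scaled ⟨
    ι k                                                ∎
  q<[x+δ]² : ι k ℚ.< (ι p ℚ.* δ ℚ.+ δ) ℚ.* (ι p ℚ.* δ ℚ.+ δ)
  q<[x+δ]² = begin-strict
    ι k                                                ≡⟨ q-scaled ⟩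
    ι (k ℕ.* (ℕ.suc n ℕ.* ℕ.suc n)) ℚ.* (δ ℚ.* δ)      <⟨ ℚ.*-monoˡ-<-pos (δ ℚ.* δ) {{δ²-pos}} (/1-mono-< (ℤ.+<+ kN²<[1+p]²)) ⟩
    ι (ℕ.suc p ℕ.* ℕ.suc p) ℚ.* (δ ℚ.* δ)              ≡⟨ square-scaled (ℕ.suc p) ⟨
    (ι (ℕ.suc p) ℚ.* δ) ℚ.* (ι (ℕ.suc p) ℚ.* δ)        ≡⟨ cong (λ y → y ℚ.* y) [1+p]δ ⟩
    (ι p ℚ.* δ ℚ.+ δ) ℚ.* (ι p ℚ.* δ ℚ.+ δ)            ∎

null-squeeze : ∀ {y z} → (∀ n → ℚ.∣ y n ∣ ℚ.≤ ℚ.∣ z n ∣) → Null z → Null y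
null-squeeze y≤z null ε 0<ε with null ε 0<ε
... | N , h = N , λ n N≤n → ℚ.≤-<-trans (y≤z n) (h n N≤n)

null⇒bounded : ∀ {z} → Null z → Bounded z
null⇒bounded null with null 1ℚ (ℚ.positive⁻¹ 1ℚ)
... | N , h = 1ℚ , ℚ.positive⁻¹ 1ℚ , N , λ n N≤n → ℚ.<⇒≤ (h n N≤n)

p<q+r⇒p-q<r : ∀ {p q r} → p ℚ.< q ℚ.+ r → p ℚ.- q ℚ.< r
p<q+r⇒p-q<r {p} {q} {r} p<q+r = subst (p ℚ.- q ℚ.<_) (cancel q r) (ℚ.+-monoˡ-< (ℚ.- q) p<q+r)
  where
  cancel : ∀ a b → a ℚ.+ b ℚ.- a ≡ b
  cancel = solve 2 (λ a b → a :+ b :- a := b) refl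
    where open +-*-Solver

module _ {q : ℚ} {δ : ℕ → ℚ} (0<δ : ∀ n → 0ℚ ℚ.< δ n) (δ-null : Null δ) (approx : ∀ n → SqrtApproximation q (δ n)) where

  private
    x : ℕ → ℚ
    x n = proj₁ (approx n)

    0≤x : ∀ n → 0ℚ ℚ.≤ x n
    0≤x n = proj₁ (proj₂ (approx n))

    x²≤q : ∀ n → x n ℚ.* x n ℚ.≤ q
    x²≤q n = proj₁ (proj₂ (proj₂ (approx n)))

    q<[x+δ]² : ∀ n → q ℚ.< (x n ℚ.+ δ n) ℚ.* (x n ℚ.+ δ n)
    q<[x+δ]² n = proj₂ (proj₂ (proj₂ (approx n)))

    -- All terms approximate one root from below: the square of `x m` is at most `q`, which is less
    -- than the square of `x n + δ n`. With the indices exchanged, this makes the sequence Cauchy.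
    difference< : ∀ m n → x m ℚ.- x n ℚ.< δ n
    difference< m n = p<q+r⇒p-q<r (square-cancel-< (0≤x m)
      (ℚ.+-mono-≤ (0≤x n) (ℚ.<⇒≤ (0<δ n))) (ℚ.≤-<-trans (x²≤q m) (q<[x+δ]² n)))

    x-cauchy : IsCauchy x
    x-cauchy ε 0<ε with δ-null ε 0<ε
    ... | N , δ<ε = N , λ m n N≤m N≤n → bound m n (δ<ε m N≤m) (δ<ε n N≤n)
      where
      bound : ∀ m n → ℚ.∣ δ m ∣ ℚ.< ε → ℚ.∣ δ n ∣ ℚ.< ε → ℚ.∣ x m ℚ.- x n ∣ ℚ.< ε
      bound m n δm<ε δn<ε with ℚ.∣p∣≡p∨∣p∣≡-p (x m ℚ.- x n)
      ... | inj₁ eq = subst (ℚ._< ε) (sym eq) (ℚ.<-trans (difference< m n) (ℚ.≤-<-trans (p≤∣p∣ (δ n)) δn<ε))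
      ... | inj₂ eq = subst (ℚ._< ε) (sym (trans eq (neg-difference (x m) (x n)))) (ℚ.<-trans (difference< n m) (ℚ.≤-<-trans (p≤∣p∣ (δ m)) δm<ε))

    limit : ℝ
    limit = record { seq = x ; cauchy = x-cauchy }

    -- The difference `(x + δ)² − x²`, which bounds `q − x²`. Each summand is a bounded sequence
    -- times a null one.
    error : ℕ → ℚ
    error n = x n ℚ.* δ n ℚ.+ (x n ℚ.* δ n ℚ.+ δ n ℚ.* δ n)

    error-null : Null error
    error-null = null-+ xδ-null (null-+ xδ-null (null-* (null⇒bounded δ-null) δ-null))
      where
      xδ-null : Null (λ n → x n ℚ.* δ n)
      xδ-null = null-* (cauchy⇒bounded x x-cauchy) δ-null

    defect≤error : ∀ n → ℚ.∣ x n ℚ.* x n ℚ.- q ∣ ℚ.≤ ℚ.∣ error n ∣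
    defect≤error n = begin
      ℚ.∣ x n ℚ.* x n ℚ.- q ∣          ≡⟨ ℚ.∣-p∣≡∣p∣ (x n ℚ.* x n ℚ.- q) ⟨
      ℚ.∣ ℚ.- (x n ℚ.* x n ℚ.- q) ∣    ≡⟨ ℚ.0≤p⇒∣p∣≡p 0≤defect ⟩
      ℚ.- (x n ℚ.* x n ℚ.- q)          ≡⟨ neg-difference (x n ℚ.* x n) q ⟩
      q ℚ.- x n ℚ.* x n                ≤⟨ ℚ.<⇒≤ (p<q+r⇒p-q<r (subst (q ℚ.<_) (expand (x n) (δ n)) (q<[x+δ]² n))) ⟩
      error n                          ≤⟨ p≤∣p∣ (error n) ⟩
      ℚ.∣ error n ∣                    ∎
      where
      open ℚ.≤-Reasoning
      expand : ∀ a d → (a ℚ.+ d) ℚ.* (a ℚ.+ d) ≡ a ℚ.* a ℚ.+ (a ℚ.* d ℚ.+ (a ℚ.* d ℚ.+ d ℚ.* d))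
      expand = solve 2 (λ a d → (a :+ d) :* (a :+ d) := a :* a :+ (a :* d :+ (a :* d :+ d :* d))) refl
        where open +-*-Solver
      0≤defect : 0ℚ ℚ.≤ ℚ.- (x n ℚ.* x n ℚ.- q)
      0≤defect = subst (0ℚ ℚ.≤_) (sym (neg-difference (x n ℚ.* x n) q))
        (subst (ℚ._≤ q ℚ.- x n ℚ.* x n) (ℚ.+-inverseʳ (x n ℚ.* x n)) (ℚ.+-monoˡ-≤ (ℚ.- (x n ℚ.* x n)) (x²≤q n)))

  sqrt-from-approximations : ∃ λ s → IsSqrt s (fromℚ q)
  sqrt-from-approximations = limit
    , (λ (mk< g 0<g N x+g<0) → ℚ.<-irrefl refl (ℚ.<-trans (ℚ.+-mono-≤-< (0≤x N) 0<g) (x+g<0 N ℕ.≤-refl)))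
    , mk≃ (null-squeeze defect≤error error-null)

sqrt-ℕ : ∀ k → ∃ λ s → IsSqrt s (fromℕ k)
sqrt-ℕ k = sqrt-from-approximations 0<1/1+ 1/1+-null (sqrt-approximation k)

-- The norm form of ℤ[ω], with (m , n) standing for m + nω

ℤ² : Set
ℤ² = ℤ × ℤ

infix  8 ⊖_
infixl 7 _*ₗ_
infixl 6 _⊟_

⊖_ : ℤ² → ℤ²
⊖ (m , n) = ℤ.- m , ℤ.- n

_⊟_ : ℤ² → ℤ² → ℤ²
(m , n) ⊟ (m′ , n′) = m ℤ.- m′ , n ℤ.- n′

_*ₗ_ : ℤ → ℤ² → ℤ²
k *ₗ (m , n) = k ℤ.* m , k ℤ.* n

combine : ℤ → ℤ → ℤ² → ℤ² → ℤ²
combine p q (m , n) (m′ , n′) = p ℤ.* m ℤ.+ q ℤ.* m′ , p ℤ.* n ℤ.+ q ℤ.* n′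

det : ℤ² → ℤ² → ℤ
det (m , n) (m′ , n′) = m ℤ.* n′ ℤ.- n ℤ.* m′

norm : ℤ² → ℤ
norm (m , n) = m ℤ.* m ℤ.- m ℤ.* n ℤ.+ n ℤ.* n

square-abs : ∀ i → i ℤ.* i ≡ + (ℤ.∣ i ∣ ℕ.* ℤ.∣ i ∣)
square-abs (+ n)      = sym (ℤ.pos-* n n)
square-abs ℤ.-[1+ n ] = refl

0≤square : ∀ i → + 0 ℤ.≤ i ℤ.* i
0≤square i = subst (+ 0 ℤ.≤_) (sym (square-abs i)) (ℤ.+≤+ ℕ.z≤n)

j≤i*i+j : ∀ i j → j ℤ.≤ i ℤ.* i ℤ.+ j
j≤i*i+j i j = subst (ℤ._≤ i ℤ.* i ℤ.+ j) (ℤ.+-identityˡ j) (ℤ.+-monoˡ-≤ j (0≤square i))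

-- Lagrange's identity for the form m² − mn + n², whose discriminant is −3.
norm-product : ∀ x y → ∃ λ t → + 4 ℤ.* (norm x ℤ.* norm y) ≡ t ℤ.* t ℤ.+ + 3 ℤ.* (det x y ℤ.* det x y)
norm-product (a , b) (m , n) = + 2 ℤ.* a ℤ.* m ℤ.- a ℤ.* n ℤ.- b ℤ.* m ℤ.+ + 2 ℤ.* b ℤ.* n , identity a b m n
  where
  identity : ∀ a b m n → + 4 ℤ.* ((a ℤ.* a ℤ.- a ℤ.* b ℤ.+ b ℤ.* b) ℤ.* (m ℤ.* m ℤ.- m ℤ.* n ℤ.+ n ℤ.* n))
    ≡ (+ 2 ℤ.* a ℤ.* m ℤ.- a ℤ.* n ℤ.- b ℤ.* m ℤ.+ + 2 ℤ.* b ℤ.* n) ℤ.* (+ 2 ℤ.* a ℤ.* m ℤ.- a ℤ.* n ℤ.- b ℤ.* m ℤ.+ + 2 ℤ.* b ℤ.* n)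
      ℤ.+ + 3 ℤ.* ((a ℤ.* n ℤ.- b ℤ.* m) ℤ.* (a ℤ.* n ℤ.- b ℤ.* m))
  identity = ℤ.solve-∀

-- The square dropped from Lagrange's identity is that of the polar form of `norm`. This one
-- estimate both confines short vectors to small coordinates and keeps `M` away from the origin
-- outside the line of `x`.
3*det²≤4*norms : ∀ x y → + 3 ℤ.* (det x y ℤ.* det x y) ℤ.≤ + 4 ℤ.* (norm x ℤ.* norm y)
3*det²≤4*norms x y with norm-product x y
... | t , eq = subst (+ 3 ℤ.* (det x y ℤ.* det x y) ℤ.≤_) (sym eq) (j≤i*i+j t (+ 3 ℤ.* (det x y ℤ.* det x y)))

data Ternary : ℤ → Set where
  zero      : Ternary (+ 0)
  one       : Ternary (+ 1)
  minus-one : Ternary ℤ.-[1+ 0 ]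

4≤[2+n]² : ∀ n → + 4 ℤ.≤ + (ℕ.suc (ℕ.suc n) ℕ.* ℕ.suc (ℕ.suc n))
4≤[2+n]² n = ℤ.+≤+ (ℕ.*-mono-≤ {2} {ℕ.suc (ℕ.suc n)} {2} (ℕ.m≤m+n 2 n) (ℕ.m≤m+n 2 n))

ternary? : ∀ i → Ternary i ⊎ + 4 ℤ.≤ i ℤ.* i
ternary? (+ 0)                = inj₁ zero
ternary? (+ 1)                = inj₁ one
ternary? (+ ℕ.suc (ℕ.suc n))  = inj₂ (4≤[2+n]² n)
ternary? ℤ.-[1+ 0 ]           = inj₁ minus-one
ternary? ℤ.-[1+ ℕ.suc n ]     = inj₂ (4≤[2+n]² n)

-- The determinant satisfies `3i² ≤ 4`, whereas `|i| ≥ 2` would make the left side at least 12.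
-- Applied to a unit `x` chosen so that `i` is a coordinate of `y`.
det≡i∧norms≤1⇒ternary : ∀ x y {i} → det x y ≡ i → norm x ≡ + 1 → norm y ℤ.≤ + 1 → Ternary i
det≡i∧norms≤1⇒ternary x y {i} refl norm-x norm-y with ternary? i
... | inj₁ t = t
... | inj₂ 4≤i² = contradiction (begin
    + 12                               ≤⟨ ℤ.*-monoˡ-≤-nonNeg (+ 3) 4≤i² ⟩
    + 3 ℤ.* (det x y ℤ.* det x y)      ≤⟨ 3*det²≤4*norms x y ⟩
    + 4 ℤ.* (norm x ℤ.* norm y)        ≡⟨ cong (λ k → + 4 ℤ.* (k ℤ.* norm y)) norm-x ⟩
    + 4 ℤ.* (+ 1 ℤ.* norm y)           ≡⟨ cong (+ 4 ℤ.*_) (ℤ.*-identityˡ (norm y)) ⟩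
    + 4 ℤ.* norm y                     ≤⟨ ℤ.*-monoˡ-≤-nonNeg (+ 4) norm-y ⟩
    + 4                                ∎) λ { (ℤ.+≤+ (ℕ.s≤s (ℕ.s≤s (ℕ.s≤s (ℕ.s≤s ()))))) }
  where open ℤ.≤-Reasoning

-- One representative of each pair ± of sixth roots of unity: 1, ω and 1 + ω.
unit : Fin 3 → ℤ²
unit zero             = + 1 , + 0
unit (suc zero)       = + 0 , + 1
unit (suc (suc zero)) = + 1 , + 1

norm-unit : ∀ i → norm (unit i) ≡ + 1
norm-unit zero             = refl
norm-unit (suc zero)       = refl
norm-unit (suc (suc zero)) = refl

unit-distinct : ∀ i j → unit i ≡ unit j ⊎ unit i ≡ ⊖ unit j → i ≡ j
unit-distinct zero             zero             _         = refl
unit-distinct zero             (suc zero)       (inj₁ ())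
unit-distinct zero             (suc zero)       (inj₂ ())
unit-distinct zero             (suc (suc zero)) (inj₁ ())
unit-distinct zero             (suc (suc zero)) (inj₂ ())
unit-distinct (suc zero)       zero             (inj₁ ())
unit-distinct (suc zero)       zero             (inj₂ ())
unit-distinct (suc zero)       (suc zero)       _         = refl
unit-distinct (suc zero)       (suc (suc zero)) (inj₁ ())
unit-distinct (suc zero)       (suc (suc zero)) (inj₂ ())
unit-distinct (suc (suc zero)) zero             (inj₁ ())
unit-distinct (suc (suc zero)) zero             (inj₂ ())
unit-distinct (suc (suc zero)) (suc zero)       (inj₁ ())
unit-distinct (suc (suc zero)) (suc zero)       (inj₂ ())
unit-distinct (suc (suc zero)) (suc (suc zero)) _         = refl

norm-⊖ : ∀ x → norm (⊖ x) ≡ norm x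
norm-⊖ (m , n) = identity m n
  where
  identity : ∀ m n → ℤ.- m ℤ.* ℤ.- m ℤ.- ℤ.- m ℤ.* ℤ.- n ℤ.+ ℤ.- n ℤ.* ℤ.- n ≡ m ℤ.* m ℤ.- m ℤ.* n ℤ.+ n ℤ.* n
  identity = ℤ.solve-∀

norm≤1 : ∀ x → norm x ℤ.≤ + 1 → x ≡ (+ 0 , + 0) ⊎ ∃ λ i → x ≡ unit i ⊎ x ≡ ⊖ unit i
norm≤1 (m , n) norm≤1 = cases ternary-m ternary-n norm≤1
  where
  ternary-m : Ternary m
  -- The determinant with `−ω` reads off the first coordinate; below, the determinant with 1 reads
  -- off the second.
  ternary-m = det≡i∧norms≤1⇒ternary (+ 0 , ℤ.- + 1) (m , n) (identity m n) refl norm≤1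
    where
    identity : ∀ m n → + 0 ℤ.* n ℤ.- ℤ.- + 1 ℤ.* m ≡ m
    identity = ℤ.solve-∀
  ternary-n : Ternary n
  ternary-n = det≡i∧norms≤1⇒ternary (+ 1 , + 0) (m , n) (identity m n) refl norm≤1
    where
    identity : ∀ m n → + 1 ℤ.* n ℤ.- + 0 ℤ.* m ≡ n
    identity = ℤ.solve-∀
  cases : ∀ {m n} → Ternary m → Ternary n → norm (m , n) ℤ.≤ + 1 →
    (m , n) ≡ (+ 0 , + 0) ⊎ ∃ λ i → (m , n) ≡ unit i ⊎ (m , n) ≡ ⊖ unit i
  cases zero      zero      _ = inj₁ refl
  cases zero      one       _ = inj₂ (suc zero , inj₁ refl)
  cases zero      minus-one _ = inj₂ (suc zero , inj₂ refl)
  cases one       zero      _ = inj₂ (zero , inj₁ refl)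
  cases one       one       _ = inj₂ (suc (suc zero) , inj₁ refl)
  cases minus-one zero      _ = inj₂ (zero , inj₂ refl)
  cases minus-one minus-one _ = inj₂ (suc (suc zero) , inj₂ refl)
  -- Coordinates of opposite sign give `±(1 − ω)`, of norm 3.
  cases one       minus-one (ℤ.+≤+ (ℕ.s≤s ()))
  cases minus-one one       (ℤ.+≤+ (ℕ.s≤s ()))

norm≡0 : ∀ x → norm x ≡ + 0 → x ≡ (+ 0 , + 0)
norm≡0 x norm-x with norm≤1 x (subst (ℤ._≤ + 1) (sym norm-x) (ℤ.+≤+ ℕ.z≤n))
... | inj₁ x≡0             = x≡0
... | inj₂ (i , inj₁ refl) = contradiction (trans (sym norm-x) (norm-unit i)) λ ()
... | inj₂ (i , inj₂ refl) = contradiction (trans (sym norm-x) (trans (norm-⊖ (unit i)) (norm-unit i))) λ ()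

-- A vector of norm at most 1 is zero or a unit: the determinant excludes zero and the assumption on
-- the norm excludes the units.
det≡1⇒1<norm : ∀ x y → det x y ≡ + 1 → norm x ≢ + 1 → + 1 ℤ.< norm x
det≡1⇒1<norm x (m , n) det≡1 norm≢1 = ℤ.≰⇒> λ small → absurd (norm≤1 x small) det≡1
  where
  absurd : x ≡ (+ 0 , + 0) ⊎ (∃ λ i → x ≡ unit i ⊎ x ≡ ⊖ unit i) → ¬ det x (m , n) ≡ + 1
  absurd (inj₁ refl)            0≡1 = contradiction (trans (sym (identity m n)) 0≡1) λ ()
    where
    identity : ∀ m n → + 0 ℤ.* n ℤ.- + 0 ℤ.* m ≡ + 0
    identity = ℤ.solve-∀
  absurd (inj₂ (i , inj₁ refl)) _   = norm≢1 (norm-unit i)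
  absurd (inj₂ (i , inj₂ refl)) _   = norm≢1 (trans (norm-⊖ (unit i)) (norm-unit i))

-- Primitive vectors and coordinates in a basis of determinant 1.

abs-multiple : ∀ i → ∃ λ s → + ℤ.∣ i ∣ ≡ s ℤ.* i
abs-multiple (+ n)      = + 1 , sym (ℤ.*-identityˡ (+ n))
abs-multiple ℤ.-[1+ n ] = ℤ.- + 1 , sym (ℤ.-1*i≡-i ℤ.-[1+ n ])

-- The determinant is linear in `y` with coefficients `a` and `−b`, so the coordinates of `y` are
-- Bézout coefficients up to sign. The identity over ℕ concerns absolute values and comes in two
-- forms according to which term is larger; `s` and `t` restore the signs.
bézout : ∀ x → gcd (proj₁ x) (proj₂ x) ≡ + 1 → ∃ λ y → det x y ≡ + 1
bézout (a , b) gcd≡1 with abs-multiple a | abs-multiple b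
... | s , ∣a∣≡sa | t , ∣b∣≡tb = from-identity (ℕ.Bézout.identity (subst (ℕ.GCD ℤ.∣ a ∣ ℤ.∣ b ∣) (ℤ.+-injective gcd≡1) (ℕ.gcd-GCD ℤ.∣ a ∣ ℤ.∣ b ∣)))
  where
  open ≡-Reasoning
  lift : ∀ k l m n → 1 ℕ.+ k ℕ.* m ≡ l ℕ.* n → + 1 ≡ + l ℤ.* + n ℤ.- + k ℤ.* + m
  lift k l m n eq = begin
    + 1                                                ≡⟨ isolate (+ 1) (+ k ℤ.* + m) ⟩
    (+ 1 ℤ.+ + k ℤ.* + m) ℤ.- + k ℤ.* + m              ≡⟨ cong (λ i → (+ 1 ℤ.+ i) ℤ.- + k ℤ.* + m) (ℤ.pos-* k m) ⟨
    + (1 ℕ.+ k ℕ.* m) ℤ.- + k ℤ.* + m                  ≡⟨ cong (λ i → + i ℤ.- + k ℤ.* + m) eq ⟩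
    + (l ℕ.* n) ℤ.- + k ℤ.* + m                        ≡⟨ cong (ℤ._- + k ℤ.* + m) (ℤ.pos-* l n) ⟩
    + l ℤ.* + n ℤ.- + k ℤ.* + m                        ∎
    where
    isolate : ∀ i j → i ≡ (i ℤ.+ j) ℤ.- j
    isolate = ℤ.solve-∀
  from-identity : ℕ.Bézout.Identity 1 ℤ.∣ a ∣ ℤ.∣ b ∣ → ∃ λ y → det (a , b) y ≡ + 1
  from-identity (ℕ.Bézout.+- k l eq) = (+ l ℤ.* t , + k ℤ.* s) , sym (begin
    + 1                                                    ≡⟨ lift l k ℤ.∣ b ∣ ℤ.∣ a ∣ eq ⟩
    + k ℤ.* + ℤ.∣ a ∣ ℤ.- + l ℤ.* + ℤ.∣ b ∣                ≡⟨ cong₂ (λ i j → + k ℤ.* i ℤ.- + l ℤ.* j) ∣a∣≡sa ∣b∣≡tb ⟩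
    + k ℤ.* (s ℤ.* a) ℤ.- + l ℤ.* (t ℤ.* b)                ≡⟨ regroup (+ k) (+ l) s t a b ⟩
    a ℤ.* (+ k ℤ.* s) ℤ.- b ℤ.* (+ l ℤ.* t)                ∎)
    where
    regroup : ∀ k l s t a b → k ℤ.* (s ℤ.* a) ℤ.- l ℤ.* (t ℤ.* b) ≡ a ℤ.* (k ℤ.* s) ℤ.- b ℤ.* (l ℤ.* t)
    regroup = ℤ.solve-∀
  from-identity (ℕ.Bézout.-+ k l eq) = (ℤ.- (+ l ℤ.* t) , ℤ.- (+ k ℤ.* s)) , sym (begin
    + 1                                                    ≡⟨ lift k l ℤ.∣ a ∣ ℤ.∣ b ∣ eq ⟩
    + l ℤ.* + ℤ.∣ b ∣ ℤ.- + k ℤ.* + ℤ.∣ a ∣                ≡⟨ cong₂ (λ i j → + l ℤ.* j ℤ.- + k ℤ.* i) ∣a∣≡sa ∣b∣≡tb ⟩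
    + l ℤ.* (t ℤ.* b) ℤ.- + k ℤ.* (s ℤ.* a)                ≡⟨ regroup (+ k) (+ l) s t a b ⟩
    a ℤ.* ℤ.- (+ k ℤ.* s) ℤ.- b ℤ.* ℤ.- (+ l ℤ.* t)        ∎)
    where
    regroup : ∀ k l s t a b → l ℤ.* (t ℤ.* b) ℤ.- k ℤ.* (s ℤ.* a) ≡ a ℤ.* ℤ.- (k ℤ.* s) ℤ.- b ℤ.* ℤ.- (l ℤ.* t)
    regroup = ℤ.solve-∀

nonzero-square : ∀ q → q ≢ + 0 → + 1 ℤ.≤ q ℤ.* q
nonzero-square (+ ℕ.zero)  q≢0 = contradiction refl q≢0
nonzero-square ℤ.+[1+ n ]  _   = ℤ.+≤+ (ℕ.s≤s ℕ.z≤n)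
nonzero-square ℤ.-[1+ n ]  _   = ℤ.+≤+ (ℕ.s≤s ℕ.z≤n)

combine-zero : ∀ x y → combine (+ 0) (+ 0) x y ≡ (+ 0 , + 0)
combine-zero x y = cong₂ _,_ (identity (proj₁ x) (proj₁ y)) (identity (proj₂ x) (proj₂ y))
  where
  identity : ∀ a c → + 0 ℤ.* a ℤ.+ + 0 ℤ.* c ≡ + 0
  identity = ℤ.solve-∀

combine-plus : ∀ x y → combine (+ 1) (+ 0) x y ≡ x
combine-plus x y = cong₂ _,_ (identity (proj₁ x) (proj₁ y)) (identity (proj₂ x) (proj₂ y))
  where
  identity : ∀ a c → + 1 ℤ.* a ℤ.+ + 0 ℤ.* c ≡ a
  identity = ℤ.solve-∀

combine-minus : ∀ x y → combine (ℤ.- + 1) (+ 0) x y ≡ ⊖ x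
combine-minus x y = cong₂ _,_ (identity (proj₁ x) (proj₁ y)) (identity (proj₂ x) (proj₂ y))
  where
  identity : ∀ a c → ℤ.- + 1 ℤ.* a ℤ.+ + 0 ℤ.* c ≡ ℤ.- a
  identity = ℤ.solve-∀

-- Division with remainder of the `y`-coordinate: removing `r` copies of `y` leaves a vector in the
-- span of `x` and `l *ₗ y`.
combine-remainder : ∀ p r k l x y → combine p (r ℤ.+ k ℤ.* l) x y ⊟ r *ₗ y ≡ combine p k x (l *ₗ y)
combine-remainder p r k l (a , b) (c , d) = cong₂ _,_ (expand p r k l a c) (expand p r k l b d)
  where
  expand : ∀ p r k l a c → p ℤ.* a ℤ.+ (r ℤ.+ k ℤ.* l) ℤ.* c ℤ.- r ℤ.* c ≡ p ℤ.* a ℤ.+ k ℤ.* (l ℤ.* c)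
  expand = ℤ.solve-∀

module _ (x y : ℤ²) (det≡1 : det x y ≡ + 1) where

  -- The contribution of `p` vanishes with `det x x`, so `det x` reads off the `y`-coordinate. Index
  -- and distance from the line of `x` are both expressed through it.
  det-combine : ∀ p q → det x (combine p q x y) ≡ q
  det-combine p q = trans (expand (proj₁ x) (proj₂ x) (proj₁ y) (proj₂ y) p q)
    (trans (cong (q ℤ.*_) det≡1) (ℤ.*-identityʳ q))
    where
    expand : ∀ a b c d p q → a ℤ.* (p ℤ.* b ℤ.+ q ℤ.* d) ℤ.- b ℤ.* (p ℤ.* a ℤ.+ q ℤ.* c) ≡ q ℤ.* (a ℤ.* d ℤ.- b ℤ.* c)
    expand = ℤ.solve-∀

  det-combine-scaled : ∀ p q l → det x (combine p q x (l *ₗ y)) ≡ q ℤ.* l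
  det-combine-scaled p q l = trans (expand (proj₁ x) (proj₂ x) (proj₁ y) (proj₂ y) p q l) (det-combine p (q ℤ.* l))
    where
    expand : ∀ a b c d p q l → a ℤ.* (p ℤ.* b ℤ.+ q ℤ.* (l ℤ.* d)) ℤ.- b ℤ.* (p ℤ.* a ℤ.+ q ℤ.* (l ℤ.* c))
      ≡ a ℤ.* (p ℤ.* b ℤ.+ q ℤ.* l ℤ.* d) ℤ.- b ℤ.* (p ℤ.* a ℤ.+ q ℤ.* l ℤ.* c)
    expand = ℤ.solve-∀

  det-scaled : ∀ l → det x (l *ₗ y) ≡ l
  det-scaled l = trans (expand (proj₁ x) (proj₂ x) (proj₁ y) (proj₂ y) l) (trans (cong (l ℤ.*_) det≡1) (ℤ.*-identityʳ l))
    where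
    expand : ∀ a b c d l → a ℤ.* (l ℤ.* d) ℤ.- b ℤ.* (l ℤ.* c) ≡ l ℤ.* (a ℤ.* d ℤ.- b ℤ.* c)
    expand = ℤ.solve-∀

  det-difference : ∀ i j → det x (i *ₗ y ⊟ j *ₗ y) ≡ i ℤ.- j
  det-difference i j = trans (expand (proj₁ x) (proj₂ x) (proj₁ y) (proj₂ y) i j) (trans (cong ((i ℤ.- j) ℤ.*_) det≡1) (ℤ.*-identityʳ (i ℤ.- j)))
    where
    expand : ∀ a b c d i j → a ℤ.* (i ℤ.* d ℤ.- j ℤ.* d) ℤ.- b ℤ.* (i ℤ.* c ℤ.- j ℤ.* c) ≡ (i ℤ.- j) ℤ.* (a ℤ.* d ℤ.- b ℤ.* c)
    expand = ℤ.solve-∀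

  -- Cramer's rule, with denominator 1.
  coordinates : ∀ z → combine (det z y) (det x z) x y ≡ z
  coordinates (m , n) = cong₂ _,_
    (trans (expand₁ (proj₁ x) (proj₂ x) (proj₁ y) (proj₂ y) m n) (trans (cong (m ℤ.*_) det≡1) (ℤ.*-identityʳ m)))
    (trans (expand₂ (proj₁ x) (proj₂ x) (proj₁ y) (proj₂ y) m n) (trans (cong (n ℤ.*_) det≡1) (ℤ.*-identityʳ n)))
    where
    expand₁ : ∀ a b c d m n → (m ℤ.* d ℤ.- n ℤ.* c) ℤ.* a ℤ.+ (a ℤ.* n ℤ.- b ℤ.* m) ℤ.* c ≡ m ℤ.* (a ℤ.* d ℤ.- b ℤ.* c)
    expand₁ = ℤ.solve-∀
    expand₂ : ∀ a b c d m n → (m ℤ.* d ℤ.- n ℤ.* c) ℤ.* b ℤ.+ (a ℤ.* n ℤ.- b ℤ.* m) ℤ.* d ≡ n ℤ.* (a ℤ.* d ℤ.- b ℤ.* c)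
    expand₂ = ℤ.solve-∀

-- Short vectors of the sublattice ℤx + ℤℓy.

module _ (x y : ℤ²) (det≡1 : det x y ≡ + 1) (1<norm : + 1 ℤ.< norm x) (ℓ : ℕ) (4norm²<3ℓ² : + 4 ℤ.* (norm x ℤ.* norm x) ℤ.< + 3 ℤ.* (+ ℓ ℤ.* + ℓ)) where

  private
    y′ : ℤ²
    y′ = (+ ℓ) *ₗ y

    norm-nonNeg : ℤ.NonNegative (norm x)
    norm-nonNeg = ℤ.nonNegative (ℤ.≤-trans (ℤ.+≤+ ℕ.z≤n) (ℤ.<⇒≤ 1<norm))

    off-line : ∀ p q → q ≢ + 0 → norm x ℤ.< norm (combine p q x y′)
    -- To stay within the integers, the quotient `3ℓ²/(4β)` is never formed: both norms are compared
    -- after multiplication by `4 · norm x`, which is cancelled.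
    off-line p q q≢0 = ℤ.*-cancelˡ-<-nonNeg (norm x) {{norm-nonNeg}} (ℤ.*-cancelˡ-<-nonNeg (+ 4) (begin-strict
      + 4 ℤ.* (norm x ℤ.* norm x)                          <⟨ 4norm²<3ℓ² ⟩
      + 3 ℤ.* (+ ℓ ℤ.* + ℓ)                                ≡⟨ cong (+ 3 ℤ.*_) (ℤ.*-identityˡ (+ ℓ ℤ.* + ℓ)) ⟨
      + 3 ℤ.* (+ 1 ℤ.* (+ ℓ ℤ.* + ℓ))                      ≤⟨ ℤ.*-monoˡ-≤-nonNeg (+ 3) (ℤ.*-monoʳ-≤-nonNeg (+ ℓ ℤ.* + ℓ) {{ℤ.nonNegative (0≤square (+ ℓ))}} (nonzero-square q q≢0)) ⟩
      + 3 ℤ.* (q ℤ.* q ℤ.* (+ ℓ ℤ.* + ℓ))                  ≡⟨ cong (+ 3 ℤ.*_) (regroup q (+ ℓ)) ⟩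
      + 3 ℤ.* (q ℤ.* + ℓ ℤ.* (q ℤ.* + ℓ))                  ≡⟨ cong (λ i → + 3 ℤ.* (i ℤ.* i)) (det-combine-scaled x y det≡1 p q (+ ℓ)) ⟨
      + 3 ℤ.* (det x z ℤ.* det x z)                        ≤⟨ 3*det²≤4*norms x z ⟩
      + 4 ℤ.* (norm x ℤ.* norm z)                          ∎))
      where
      open ℤ.≤-Reasoning
      z : ℤ²
      z = combine p q x y′
      regroup : ∀ q l → q ℤ.* q ℤ.* (l ℤ.* l) ≡ q ℤ.* l ℤ.* (q ℤ.* l)
      regroup = ℤ.solve-∀

    norm-line : ∀ p → norm (combine p (+ 0) x y′) ≡ p ℤ.* p ℤ.* norm x
    norm-line p = identity (proj₁ x) (proj₂ x) (proj₁ y′) (proj₂ y′) p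
      where
      identity : ∀ a b c d p → (p ℤ.* a ℤ.+ + 0 ℤ.* c) ℤ.* (p ℤ.* a ℤ.+ + 0 ℤ.* c) ℤ.- (p ℤ.* a ℤ.+ + 0 ℤ.* c) ℤ.* (p ℤ.* b ℤ.+ + 0 ℤ.* d) ℤ.+ (p ℤ.* b ℤ.+ + 0 ℤ.* d) ℤ.* (p ℤ.* b ℤ.+ + 0 ℤ.* d)
        ≡ p ℤ.* p ℤ.* (a ℤ.* a ℤ.- a ℤ.* b ℤ.+ b ℤ.* b)
      identity = ℤ.solve-∀

    on-line : ∀ p → + 4 ℤ.≤ p ℤ.* p → norm x ℤ.< norm (combine p (+ 0) x y′)
    on-line p 4≤p² = begin-strict
      norm x                           ≡⟨ ℤ.*-identityˡ (norm x) ⟨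
      + 1 ℤ.* norm x                   <⟨ ℤ.*-monoʳ-<-pos (norm x) {{ℤ.positive (ℤ.<-trans (ℤ.+<+ (ℕ.s≤s ℕ.z≤n)) 1<norm)}} {+ 1} {+ 4} (ℤ.+<+ (ℕ.s≤s (ℕ.s≤s ℕ.z≤n))) ⟩
      + 4 ℤ.* norm x                   ≤⟨ ℤ.*-monoʳ-≤-nonNeg (norm x) {{norm-nonNeg}} 4≤p² ⟩
      p ℤ.* p ℤ.* norm x               ≡⟨ norm-line p ⟨
      norm (combine p (+ 0) x y′)      ∎
      where open ℤ.≤-Reasoning

  -- The rows of multiples of x in ℤx + ℤℓy lie (√3/2)ℓ/√(norm x) apart, which exceeds √(norm x).
  sublattice-minimum : ∀ p q → (combine p q x y′ ≡ (+ 0 , + 0) ⊎ combine p q x y′ ≡ x ⊎ combine p q x y′ ≡ ⊖ x) ⊎ norm x ℤ.< norm (combine p q x y′)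
  sublattice-minimum p q with q ℤ.≟ + 0
  ... | no q≢0 = inj₂ (off-line p q q≢0)
  ... | yes refl with ternary? p
  ... | inj₂ 4≤p²      = inj₂ (on-line p 4≤p²)
  ... | inj₁ zero      = inj₁ (inj₁ (combine-zero x y′))
  ... | inj₁ one       = inj₁ (inj₂ (inj₁ (combine-plus x y′)))
  ... | inj₁ minus-one = inj₁ (inj₂ (inj₂ (combine-minus x y′)))

-- Two residues differ by less than `ℓ` in absolute value, which forces `|k| < 1`.
multiple-between : ∀ {i j ℓ} k → i ℕ.< ℓ → j ℕ.< ℓ → + i ℤ.- + j ≡ k ℤ.* + ℓ → i ≡ j
multiple-between {i} {j} {ℓ} k i<ℓ j<ℓ eq = ℤ.+-injective (ℤ.i-j≡0⇒i≡j (+ i) (+ j)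
  (trans eq (trans (cong (ℤ._* + ℓ) (ℤ.∣i∣≡0⇒i≡0 {k} (ℕ.n<1⇒n≡0 (ℕ.*-cancelʳ-< ℓ ℤ.∣ k ∣ 1 (begin-strict
    ℤ.∣ k ∣ ℕ.* ℓ           ≡⟨ ℤ.abs-* k (+ ℓ) ⟨
    ℤ.∣ k ℤ.* + ℓ ∣         ≡⟨ cong ℤ.∣_∣ eq ⟨
    ℤ.∣ + i ℤ.- + j ∣       ≡⟨ cong ℤ.∣_∣ (ℤ.m-n≡m⊖n i j) ⟩
    ℤ.∣ i ℤ.⊖ j ∣           ≤⟨ ℤ.∣m⊝n∣≤m⊔n i j ⟩
    i ℕ.⊔ j                 <⟨ ℕ.⊔-lub i<ℓ j<ℓ ⟩
    ℓ                       ≡⟨ ℕ.*-identityˡ ℓ ⟨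
    1 ℕ.* ℓ                 ∎))))) refl)))
  where open ℕ.≤-Reasoning

-- The hexagonal lattice

≈-refl : ∀ {v} → v ≈ v
≈-refl = ≃-refl , ≃-refl

≈-sym : ∀ {v w} → v ≈ w → w ≈ v
≈-sym (p , q) = ≃-sym p , ≃-sym q

≈-trans : ∀ {u v w} → u ≈ v → v ≈ w → u ≈ w
≈-trans (p , q) (p′ , q′) = ≃-trans p p′ , ≃-trans q q′

+ᵛ-cong : ∀ {v v′ w w′} → v ≈ v′ → w ≈ w′ → v +ᵛ w ≈ v′ +ᵛ w′
+ᵛ-cong (p , q) (p′ , q′) = +-cong p p′ , +-cong q q′

A-cong : ∀ {v w} → v ≈ w → A v ≃ A w
A-cong (p , q) = +-cong (*-cong p p) (*-cong q q)

1·v≈v : ∀ v → 1ℝ · v ≈ v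
1·v≈v (x , y) = pointwise (λ n → ℚ.*-identityˡ (seq x n)) , pointwise (λ n → ℚ.*-identityˡ (seq y n))

ℤ-span-ext : ∀ e₁ e₂ → Extensional (ℤ-span e₁ e₂)
ℤ-span-ext e₁ e₂ v≈w (m , n , v≈) = m , n , ≈-trans (≈-sym v≈w) v≈

-- Scaling by 1 still yields a different predicate: it provides a member of `X` only equivalent to
-- `v`, and extensionality carries membership over.
scale-1⁻ : ∀ {X} → Extensional X → ∀ {v} → v ∈ scale 1ℝ X → v ∈ X
scale-1⁻ ext (w , w∈X , v≈1w) = ext (≈-sym (≈-trans v≈1w (1·v≈v w))) w∈X

scale-1⁺ : ∀ {X : Subset} {v} → v ∈ X → v ∈ scale 1ℝ X
scale-1⁺ {v = v} v∈X = v , v∈X , ≈-sym (1·v≈v v)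

-- Brings a relation l ≃ r into the scope of the ring solver: prove the identity with a multiple of l − r added.
+-multiple : ∀ {x l r} k → l ≃ r → x + k * (l + - r) ≃ x
+-multiple {x} {l} {r} k l≃r = ≃-trans (+-cong ≃-refl (*-cong ≃-refl (+-cong l≃r ≃-refl))) (cancel x k r)
  where
  cancel : ∀ x k r → x + k * (r + - r) ≃ x
  cancel = solve 3 (λ x k r → x :+ k :* (r :+ :- r) := x) ≃-refl
    where open ℝ-Solver

combination-zero : ∀ {x y} k l → x ≃ 0ℝ → y ≃ 0ℝ → k * x + l * y ≃ 0ℝ
combination-zero k l x≃0 y≃0 = ≃-trans (+-cong (*-cong ≃-refl x≃0) (*-cong ≃-refl y≃0)) (zeros k l)
  where
  zeros : ∀ k l → k * 0ℝ + l * 0ℝ ≃ 0ℝ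
  zeros = solve 2 (λ k l → k :* con 0ℚ :+ l :* con 0ℚ := con 0ℚ) ≃-refl
    where open ℝ-Solver

fromℤ-combination : ∀ p m q n → fromℤ (p ℤ.* m ℤ.+ q ℤ.* n) ≃ fromℤ p * fromℤ m + fromℤ q * fromℤ n
fromℤ-combination p m q n = ≃-trans (fromℤ-+ (p ℤ.* m) (q ℤ.* n)) (+-cong (fromℤ-* p m) (fromℤ-* q n))

fromℤ-norm : ∀ x → fromℤ (norm x) ≃ fromℤ (proj₁ x) * fromℤ (proj₁ x) + - (fromℤ (proj₁ x) * fromℤ (proj₂ x)) + fromℤ (proj₂ x) * fromℤ (proj₂ x)
fromℤ-norm (m , n) = ≃-trans (fromℤ-+ (m ℤ.* m ℤ.- m ℤ.* n) (n ℤ.* n)) (+-cong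
  (≃-trans (fromℤ-+ (m ℤ.* m) (ℤ.- (m ℤ.* n))) (+-cong (fromℤ-* m m) (≃-trans (fromℤ-neg (m ℤ.* n)) (-‿cong (fromℤ-* m n)))))
  (fromℤ-* n n))

-ᵛ-inverse : ∀ v → v -ᵛ v ≈ 0ᵛ
-ᵛ-inverse (x , y) = pointwise (λ n → ℚ.+-inverseʳ (seq x n)) , pointwise (λ n → ℚ.+-inverseʳ (seq y n))

difference≃0 : ∀ {x y} → x + - y ≃ 0ℝ → x ≃ y
difference≃0 {x} {y} x-y≃0 = ≃-trans (split x y) (≃-trans (+-cong x-y≃0 ≃-refl) (pointwise λ n → ℚ.+-identityˡ (seq y n)))
  where
  split : ∀ x y → x ≃ (x + - y) + y
  split = solve 2 (λ x y → x := (x :+ :- y) :+ y) ≃-refl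
    where open ℝ-Solver

fromℤ-difference : ∀ m n → fromℤ (m ℤ.- n) ≃ fromℤ m + - fromℤ n
fromℤ-difference m n = ≃-trans (fromℤ-+ m (ℤ.- n)) (+-cong ≃-refl (fromℤ-neg n))

module Hexagonal (√3 : ℝ) (√3-squared : √3 * √3 ≃ fromℕ 3) where

  private
    1/6 1/4 1/3 2/3 4/3 : ℚ
    1/6 = + 1 ℚ./ 6
    1/4 = + 1 ℚ./ 4
    1/3 = + 1 ℚ./ 3
    2/3 = + 2 ℚ./ 3
    4/3 = + 4 ℚ./ 3

  1ᵛ ω : ℝ²
  1ᵛ = 1ℝ , 0ℝ
  ω  = fromℚ (ℚ.- ½) , fromℚ ½ * √3

  point : ℝ → ℝ → ℝ²
  point x y = x · 1ᵛ +ᵛ y · ω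

  point-cong : ∀ {x x′ y y′} → x ≃ x′ → y ≃ y′ → point x y ≈ point x′ y′
  point-cong x≃ y≃ = +-cong (*-cong x≃ ≃-refl) (*-cong y≃ ≃-refl) , +-cong (*-cong x≃ ≃-refl) (*-cong y≃ ≃-refl)

  point-combination : ∀ p x y q x′ y′ → p · point x y +ᵛ q · point x′ y′ ≈ point (p * x + q * x′) (p * y + q * y′)
  point-combination p x y q x′ y′ = coordinate 1ℝ (fromℚ (ℚ.- ½)) p x y q x′ y′ , coordinate 0ℝ (fromℚ ½ * √3) p x y q x′ y′
    where
    coordinate : ∀ e f p x y q x′ y′ → p * (x * e + y * f) + q * (x′ * e + y′ * f) ≃ (p * x + q * x′) * e + (p * y + q * y′) * f
    coordinate = solve 8 (λ e f p x y q x′ y′ → p :* (x :* e :+ y :* f) :+ q :* (x′ :* e :+ y′ :* f) := (p :* x :+ q :* x′) :* e :+ (p :* y :+ q :* y′) :* f) ≃-refl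
      where open ℝ-Solver

  point-neg : ∀ x y → -ᵛ point x y ≈ point (- x) (- y)
  point-neg x y = coordinate 1ℝ (fromℚ (ℚ.- ½)) x y , coordinate 0ℝ (fromℚ ½ * √3) x y
    where
    coordinate : ∀ e f x y → - (x * e + y * f) ≃ - x * e + - y * f
    coordinate = solve 4 (λ e f x y → :- (x :* e :+ y :* f) := :- x :* e :+ :- y :* f) ≃-refl
      where open ℝ-Solver

  point-difference : ∀ x y x′ y′ → point x y -ᵛ point x′ y′ ≈ point (x + - x′) (y + - y′)
  point-difference x y x′ y′ = coordinate 1ℝ (fromℚ (ℚ.- ½)) x y x′ y′ , coordinate 0ℝ (fromℚ ½ * √3) x y x′ y′
    where
    coordinate : ∀ e f x y x′ y′ → (x * e + y * f) + - (x′ * e + y′ * f) ≃ (x + - x′) * e + (y + - y′) * f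
    coordinate = solve 6 (λ e f x y x′ y′ → (x :* e :+ y :* f) :+ :- (x′ :* e :+ y′ :* f) := (x :+ :- x′) :* e :+ (y :+ :- y′) :* f) ≃-refl
      where open ℝ-Solver

  A-point : ∀ x y → A (point x y) ≃ x * x + - (x * y) + y * y
  -- The square of `√3` arises only from `(½√3 y)²`, whence the multiplier `y²/4`.
  A-point x y = ≃-trans (expand √3 x y) (+-multiple (fromℚ 1/4 * y * y) √3-squared)
    where
    expand : ∀ s x y → (x * 1ℝ + y * fromℚ (ℚ.- ½)) * (x * 1ℝ + y * fromℚ (ℚ.- ½)) + (x * 0ℝ + y * (fromℚ ½ * s)) * (x * 0ℝ + y * (fromℚ ½ * s))
      ≃ (x * x + - (x * y) + y * y) + fromℚ 1/4 * y * y * (s * s + - fromℕ 3)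
    expand = solve 3 (λ s x y → (x :* con 1ℚ :+ y :* con (ℚ.- ½)) :* (x :* con 1ℚ :+ y :* con (ℚ.- ½)) :+ (x :* con 0ℚ :+ y :* (con ½ :* s)) :* (x :* con 0ℚ :+ y :* (con ½ :* s))
      := (x :* x :+ :- (x :* y) :+ y :* y) :+ con 1/4 :* y :* y :* (s :* s :+ :- con (+ 3 ℚ./ 1))) ≃-refl
      where open ℝ-Solver

  real-coordinates : ∀ v → ∃₂ λ x y → v ≈ point x y
  -- The solution of `x − y/2 = u` and `½√3 y = v`, with `1/√3` written as `√3/3`.
  real-coordinates (u , v) = u + fromℚ 1/3 * √3 * v , fromℚ 2/3 * √3 * v , ≃-sym (first √3 u v) , ≃-sym second
    where
    first : ∀ s u v → (u + fromℚ 1/3 * s * v) * 1ℝ + fromℚ 2/3 * s * v * fromℚ (ℚ.- ½) ≃ u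
    first = solve 3 (λ s u v → (u :+ con 1/3 :* s :* v) :* con 1ℚ :+ con 2/3 :* s :* v :* con (ℚ.- ½) := u) ≃-refl
      where open ℝ-Solver
    expand : ∀ s u v → (u + fromℚ 1/3 * s * v) * 0ℝ + fromℚ 2/3 * s * v * (fromℚ ½ * s) ≃ v + fromℚ 1/3 * v * (s * s + - fromℕ 3)
    expand = solve 3 (λ s u v → (u :+ con 1/3 :* s :* v) :* con 0ℚ :+ con 2/3 :* s :* v :* (con ½ :* s) := v :+ con 1/3 :* v :* (s :* s :+ :- con (+ 3 ℚ./ 1))) ≃-refl
      where open ℝ-Solver
    second : (u + fromℚ 1/3 * √3 * v) * 0ℝ + fromℚ 2/3 * √3 * v * (fromℚ ½ * √3) ≃ v
    second = ≃-trans (expand √3 u v) (+-multiple (fromℚ 1/3 * v) √3-squared)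

  point≈0 : ∀ x y → point x y ≈ 0ᵛ → x ≃ 0ℝ × y ≃ 0ℝ
  point≈0 x y (u≃0 , v≃0) =
      ≃-trans (≃-sym (+-multiple (fromℚ 1/6 * y) √3-squared)) (≃-trans (expand-x √3 x y) (combination-zero 1ℝ (fromℚ 1/3 * √3) u≃0 v≃0))
    , ≃-trans (≃-sym (+-multiple (fromℚ 1/3 * y) √3-squared)) (≃-trans (expand-y √3 x y) (combination-zero 0ℝ (fromℚ 2/3 * √3) u≃0 v≃0))
    where
    expand-x : ∀ s x y → x + fromℚ 1/6 * y * (s * s + - fromℕ 3) ≃ 1ℝ * (x * 1ℝ + y * fromℚ (ℚ.- ½)) + fromℚ 1/3 * s * (x * 0ℝ + y * (fromℚ ½ * s))
    expand-x = solve 3 (λ s x y → x :+ con 1/6 :* y :* (s :* s :+ :- con (+ 3 ℚ./ 1)) := con 1ℚ :* (x :* con 1ℚ :+ y :* con (ℚ.- ½)) :+ con 1/3 :* s :* (x :* con 0ℚ :+ y :* (con ½ :* s))) ≃-refl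
      where open ℝ-Solver
    expand-y : ∀ s x y → y + fromℚ 1/3 * y * (s * s + - fromℕ 3) ≃ 0ℝ * (x * 1ℝ + y * fromℚ (ℚ.- ½)) + fromℚ 2/3 * s * (x * 0ℝ + y * (fromℚ ½ * s))
    expand-y = solve 3 (λ s x y → y :+ con 1/3 :* y :* (s :* s :+ :- con (+ 3 ℚ./ 1)) := con 0ℚ :* (x :* con 1ℚ :+ y :* con (ℚ.- ½)) :+ con 2/3 :* s :* (x :* con 0ℚ :+ y :* (con ½ :* s))) ≃-refl
      where open ℝ-Solver

  1-ω-basis : IsBasis 1ᵛ ω
  1-ω-basis = record { spanning = real-coordinates ; independent = point≈0 }

  -- Cramer's rule over ℝ. The inverse `r` of the determinant is passed in, since inverting a real
  -- would require an apartness proof; for `M` the determinant is `ℓ` and `r` is the rational `1/ℓ`.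
  basis-change : ∀ a b c d r → r * (a * d + - (b * c)) ≃ 1ℝ → IsBasis (point a b) (point c d)
  basis-change a b c d r r-inverse = record { spanning = spanning ; independent = independent }
    where
    spanning : ∀ v → ∃₂ λ p q → v ≈ p · point a b +ᵛ q · point c d
    spanning v = from-coordinates (real-coordinates v)
      where
      expand₁ : ∀ a b c d r x y → r * (x * d + - (y * c)) * a + r * (a * y + - (b * x)) * c ≃ x + x * (r * (a * d + - (b * c)) + - 1ℝ)
      expand₁ = solve 7 (λ a b c d r x y → r :* (x :* d :+ :- (y :* c)) :* a :+ r :* (a :* y :+ :- (b :* x)) :* c := x :+ x :* (r :* (a :* d :+ :- (b :* c)) :+ :- con 1ℚ)) ≃-refl
        where open ℝ-Solver
      expand₂ : ∀ a b c d r x y → r * (x * d + - (y * c)) * b + r * (a * y + - (b * x)) * d ≃ y + y * (r * (a * d + - (b * c)) + - 1ℝ)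
      expand₂ = solve 7 (λ a b c d r x y → r :* (x :* d :+ :- (y :* c)) :* b :+ r :* (a :* y :+ :- (b :* x)) :* d := y :+ y :* (r :* (a :* d :+ :- (b :* c)) :+ :- con 1ℚ)) ≃-refl
        where open ℝ-Solver
      from-coordinates : (∃₂ λ x y → v ≈ point x y) → ∃₂ λ p q → v ≈ p · point a b +ᵛ q · point c d
      from-coordinates (x , y , v≈) = p , q , ≈-trans v≈ (≈-sym (≈-trans (point-combination p a b q c d) (point-cong
          (≃-trans (expand₁ a b c d r x y) (+-multiple x r-inverse))
          (≃-trans (expand₂ a b c d r x y) (+-multiple y r-inverse)))))
        where
        p q : ℝ
        p = r * (x * d + - (y * c))
        q = r * (a * y + - (b * x))
    independent : ∀ p q → p · point a b +ᵛ q · point c d ≈ 0ᵛ → p ≃ 0ℝ × q ≃ 0ℝ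
    independent p q combination≈0 =
        ≃-trans (≃-sym (+-multiple p r-inverse)) (≃-trans (expand-p a b c d r p q) (combination-zero (r * d) (- (r * c)) (proj₁ coordinates≃0) (proj₂ coordinates≃0)))
      , ≃-trans (≃-sym (+-multiple q r-inverse)) (≃-trans (expand-q a b c d r p q) (combination-zero (- (r * b)) (r * a) (proj₁ coordinates≃0) (proj₂ coordinates≃0)))
      where
      coordinates≃0 : p * a + q * c ≃ 0ℝ × p * b + q * d ≃ 0ℝ
      coordinates≃0 = point≈0 (p * a + q * c) (p * b + q * d) (≈-trans (≈-sym (point-combination p a b q c d)) combination≈0)
      expand-p : ∀ a b c d r p q → p + p * (r * (a * d + - (b * c)) + - 1ℝ) ≃ r * d * (p * a + q * c) + - (r * c) * (p * b + q * d)
      expand-p = solve 7 (λ a b c d r p q → p :+ p :* (r :* (a :* d :+ :- (b :* c)) :+ :- con 1ℚ) := r :* d :* (p :* a :+ q :* c) :+ :- (r :* c) :* (p :* b :+ q :* d)) ≃-refl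
        where open ℝ-Solver
      expand-q : ∀ a b c d r p q → q + q * (r * (a * d + - (b * c)) + - 1ℝ) ≃ - (r * b) * (p * a + q * c) + r * a * (p * b + q * d)
      expand-q = solve 7 (λ a b c d r p q → q :+ q :* (r :* (a :* d :+ :- (b :* c)) :+ :- con 1ℚ) := :- (r :* b) :* (p :* a :+ q :* c) :+ r :* a :* (p :* b :+ q :* d)) ≃-refl
        where open ℝ-Solver

  φ : ℤ² → ℝ²
  φ (m , n) = point (fromℤ m) (fromℤ n)

  φ-combine : ∀ p q x y → fromℤ p · φ x +ᵛ fromℤ q · φ y ≈ φ (combine p q x y)
  φ-combine p q (m , n) (m′ , n′) = ≈-trans
    (point-combination (fromℤ p) (fromℤ m) (fromℤ n) (fromℤ q) (fromℤ m′) (fromℤ n′))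
    (point-cong (≃-sym (fromℤ-combination p m q m′)) (≃-sym (fromℤ-combination p n q n′)))

  φ-⊖ : ∀ x → -ᵛ φ x ≈ φ (⊖ x)
  φ-⊖ (m , n) = ≈-trans (point-neg (fromℤ m) (fromℤ n)) (point-cong (≃-sym (fromℤ-neg m)) (≃-sym (fromℤ-neg n)))

  φ-⊟ : ∀ x y → φ x -ᵛ φ y ≈ φ (x ⊟ y)
  φ-⊟ (m , n) (m′ , n′) = ≈-trans (point-difference (fromℤ m) (fromℤ n) (fromℤ m′) (fromℤ n′))
    (point-cong (≃-sym (fromℤ-difference m m′)) (≃-sym (fromℤ-difference n n′)))

  φ-0 : φ (+ 0 , + 0) ≈ 0ᵛ
  φ-0 = zeros 1ℝ (fromℚ (ℚ.- ½)) , zeros 0ℝ (fromℚ ½ * √3)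
    where
    zeros : ∀ k l → 0ℝ * k + 0ℝ * l ≃ 0ℝ
    zeros = solve 2 (λ k l → con 0ℚ :* k :+ con 0ℚ :* l := con 0ℚ) ≃-refl
      where open ℝ-Solver

  A-φ : ∀ x → A (φ x) ≃ fromℤ (norm x)
  A-φ x = ≃-trans (A-point (fromℤ (proj₁ x)) (fromℤ (proj₂ x))) (≃-sym (fromℤ-norm x))

  -- The way back from real vectors to integers: independence of 1 and ω makes the coordinate
  -- differences vanish in ℝ, and ℤ embeds injectively.
  φ-injective : ∀ x y → φ x ≈ φ y → x ≡ y
  φ-injective (m , n) (m′ , n′) φx≈φy = cong₂ _,_ (fromℤ-injective (difference≃0 (proj₁ differences≃0))) (fromℤ-injective (difference≃0 (proj₂ differences≃0)))
    where
    differences≃0 : fromℤ m + - fromℤ m′ ≃ 0ℝ × fromℤ n + - fromℤ n′ ≃ 0ℝ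
    differences≃0 = point≈0 (fromℤ m + - fromℤ m′) (fromℤ n + - fromℤ n′) (≈-trans
      (≈-sym (point-difference (fromℤ m) (fromℤ n) (fromℤ m′) (fromℤ n′)))
      (≈-trans (+ᵛ-cong φx≈φy ≈-refl) (-ᵛ-inverse (φ (m′ , n′)))))

  -- Stated up to `≈`, which makes it extensional, and in exactly the shape of the field `members`,
  -- which then holds by the identity.
  Pairs : ∀ {k} → (Fin k → ℤ²) → Subset
  Pairs u v = ∃ λ i → v ≈ φ (u i) ⊎ v ≈ -ᵛ φ (u i)

  Pairs-ext : ∀ {k} (u : Fin k → ℤ²) → Extensional (Pairs u)
  Pairs-ext u v≈w (i , inj₁ v≈) = i , inj₁ (≈-trans (≈-sym v≈w) v≈)
  Pairs-ext u v≈w (i , inj₂ v≈) = i , inj₂ (≈-trans (≈-sym v≈w) v≈)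

  Pairs⁻ : ∀ {k} (u : Fin k → ℤ²) {v} → v ∈ Pairs u → ∃₂ λ i z → v ≈ φ z × (z ≡ u i ⊎ z ≡ ⊖ u i)
  Pairs⁻ u (i , inj₁ v≈) = i , u i , v≈ , inj₁ refl
  Pairs⁻ u (i , inj₂ v≈) = i , ⊖ u i , ≈-trans v≈ (φ-⊖ (u i)) , inj₂ refl

  Pairs⁺ : ∀ {k} (u : Fin k → ℤ²) {v z} i → v ≈ φ z → z ≡ u i ⊎ z ≡ ⊖ u i → v ∈ Pairs u
  Pairs⁺ u i v≈ (inj₁ refl) = i , inj₁ v≈
  Pairs⁺ u i v≈ (inj₂ refl) = i , inj₂ (≈-trans v≈ (≈-sym (φ-⊖ (u i))))

  norm-± : ∀ {z w} → z ≡ w ⊎ z ≡ ⊖ w → norm z ≡ norm w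
  norm-±         (inj₁ refl) = refl
  norm-± {w = w} (inj₂ refl) = norm-⊖ w

  A-Pairs : ∀ {k} (u : Fin k → ℤ²) {l} → (∀ i → norm (u i) ≡ l) → ∀ v → v ∈ Pairs u → A v ≃ fromℤ l
  A-Pairs u norm≡l v v∈ = let i , z , v≈ , z≡ = Pairs⁻ u v∈ in
    ≃-trans (A-cong v≈) (≃-trans (A-φ z) (pointwise λ _ → cong (ℚ._/ 1) (trans (norm-± z≡) (norm≡l i))))

  consistsOfPairs : ∀ {k} (u : Fin k → ℤ²) → (∀ i j → u i ≡ u j ⊎ u i ≡ ⊖ u j → i ≡ j) → ConsistsOfPairs k (Pairs u)
  consistsOfPairs u distinct = record
    { vec      = λ i → φ (u i)
    ; members  = λ _ → mk⇔ id id
    ; distinct = λ { i j (inj₁ eq) → distinct i j (inj₁ (φ-injective (u i) (u j) eq))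
                   ; i j (inj₂ eq) → distinct i j (inj₂ (φ-injective (u i) (⊖ u j) (≈-trans eq (φ-⊖ (u j))))) } }

  -- The values at the three pairs of units determine a quadratic form.

  B-1 : ∀ p q r → form p q r ⟦ φ (unit zero) ⟧ ≃ p
  B-1 p q r = expand p q r √3
    where
    -- The coordinates are kept unreduced so that the left side is definitionally the value of the
    -- form at the unit; the same is done for the other two units.
    expand : ∀ p q r s → p * ((1ℝ * 1ℝ + 0ℝ * fromℚ (ℚ.- ½)) * (1ℝ * 1ℝ + 0ℝ * fromℚ (ℚ.- ½)))
      + q * ((1ℝ * 1ℝ + 0ℝ * fromℚ (ℚ.- ½)) * (1ℝ * 0ℝ + 0ℝ * (fromℚ ½ * s)))
      + r * ((1ℝ * 0ℝ + 0ℝ * (fromℚ ½ * s)) * (1ℝ * 0ℝ + 0ℝ * (fromℚ ½ * s))) ≃ p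
    expand = solve 4 (λ p q r s → let x = con 1ℚ :* con 1ℚ :+ con 0ℚ :* con (ℚ.- ½)
                                      y = con 1ℚ :* con 0ℚ :+ con 0ℚ :* (con ½ :* s) in
      p :* (x :* x) :+ q :* (x :* y) :+ r :* (y :* y) := p) ≃-refl
      where open ℝ-Solver

  B-ω : ∀ p q r → form p q r ⟦ φ (unit (suc zero)) ⟧ ≃ fromℚ 1/4 * (p + - (q * √3) + r * (√3 * √3))
  B-ω p q r = expand p q r √3
    where
    expand : ∀ p q r s → p * ((0ℝ * 1ℝ + 1ℝ * fromℚ (ℚ.- ½)) * (0ℝ * 1ℝ + 1ℝ * fromℚ (ℚ.- ½)))
      + q * ((0ℝ * 1ℝ + 1ℝ * fromℚ (ℚ.- ½)) * (0ℝ * 0ℝ + 1ℝ * (fromℚ ½ * s)))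
      + r * ((0ℝ * 0ℝ + 1ℝ * (fromℚ ½ * s)) * (0ℝ * 0ℝ + 1ℝ * (fromℚ ½ * s))) ≃ fromℚ 1/4 * (p + - (q * s) + r * (s * s))
    expand = solve 4 (λ p q r s → let x = con 0ℚ :* con 1ℚ :+ con 1ℚ :* con (ℚ.- ½)
                                      y = con 0ℚ :* con 0ℚ :+ con 1ℚ :* (con ½ :* s) in
      p :* (x :* x) :+ q :* (x :* y) :+ r :* (y :* y) := con 1/4 :* (p :+ :- (q :* s) :+ r :* (s :* s))) ≃-refl
      where open ℝ-Solver

  B-1+ω : ∀ p q r → form p q r ⟦ φ (unit (suc (suc zero))) ⟧ ≃ fromℚ 1/4 * (p + q * √3 + r * (√3 * √3))
  B-1+ω p q r = expand p q r √3
    where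
    expand : ∀ p q r s → p * ((1ℝ * 1ℝ + 1ℝ * fromℚ (ℚ.- ½)) * (1ℝ * 1ℝ + 1ℝ * fromℚ (ℚ.- ½)))
      + q * ((1ℝ * 1ℝ + 1ℝ * fromℚ (ℚ.- ½)) * (1ℝ * 0ℝ + 1ℝ * (fromℚ ½ * s)))
      + r * ((1ℝ * 0ℝ + 1ℝ * (fromℚ ½ * s)) * (1ℝ * 0ℝ + 1ℝ * (fromℚ ½ * s))) ≃ fromℚ 1/4 * (p + q * s + r * (s * s))
    expand = solve 4 (λ p q r s → let x = con 1ℚ :* con 1ℚ :+ con 1ℚ :* con (ℚ.- ½)
                                      y = con 1ℚ :* con 0ℚ :+ con 1ℚ :* (con ½ :* s) in
      p :* (x :* x) :+ q :* (x :* y) :+ r :* (y :* y) := con 1/4 :* (p :+ q :* s :+ r :* (s :* s))) ≃-refl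
      where open ℝ-Solver

  -- The three values are a linear system for `p`, `q`, `r`. The value at 1 is `p`; the value at
  -- `1 + ω` minus that at `ω` is `½√3 q`; and four times the value at `ω` is `p − √3 q + 3r`.
  units-determine-form : ∀ B → (∀ i → B ⟦ φ (unit i) ⟧ ≃ 1ℝ) → ∀ v → B ⟦ v ⟧ ≃ A v
  units-determine-form (form p q r) on-units (x , y) =
    ≃-trans (+-cong (+-cong (*-cong p≃1 ≃-refl) (*-cong q≃0 ≃-refl)) (*-cong r≃1 ≃-refl)) (simplify x y)
    where
    simplify : ∀ x y → 1ℝ * (x * x) + 0ℝ * (x * y) + 1ℝ * (y * y) ≃ x * x + y * y
    simplify = solve 2 (λ x y → con 1ℚ :* (x :* x) :+ con 0ℚ :* (x :* y) :+ con 1ℚ :* (y :* y) := x :* x :+ y :* y) ≃-refl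
      where open ℝ-Solver
    at-ω : fromℚ 1/4 * (p + - (q * √3) + r * (√3 * √3)) ≃ 1ℝ
    at-ω = ≃-trans (≃-sym (B-ω p q r)) (on-units (suc zero))
    at-1+ω : fromℚ 1/4 * (p + q * √3 + r * (√3 * √3)) ≃ 1ℝ
    at-1+ω = ≃-trans (≃-sym (B-1+ω p q r)) (on-units (suc (suc zero)))
    p≃1 : p ≃ 1ℝ
    p≃1 = ≃-trans (≃-sym (B-1 p q r)) (on-units zero)
    q≃0 : q ≃ 0ℝ
    q≃0 = ≃-trans (≃-sym (+-multiple (fromℚ 1/3 * q) √3-squared))
      -- The factor `⅔√3` is the inverse of the coefficient `½√3` of `q` in the difference of the
      -- two values.
      (≃-trans (expand p q r √3) (+-multiple (fromℚ 2/3 * √3) (≃-trans at-1+ω (≃-sym at-ω))))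
      where
      expand : ∀ p q r s → q + fromℚ 1/3 * q * (s * s + - fromℕ 3)
        ≃ 0ℝ + fromℚ 2/3 * s * (fromℚ 1/4 * (p + q * s + r * (s * s)) + - (fromℚ 1/4 * (p + - (q * s) + r * (s * s))))
      expand = solve 4 (λ p q r s → q :+ con 1/3 :* q :* (s :* s :+ :- con (+ 3 ℚ./ 1))
        := con 0ℚ :+ con 2/3 :* s :* (con 1/4 :* (p :+ q :* s :+ r :* (s :* s)) :+ :- (con 1/4 :* (p :+ :- (q :* s) :+ r :* (s :* s))))) ≃-refl
        where open ℝ-Solver
    r≃1 : r ≃ 1ℝ
    r≃1 = ≃-trans (≃-sym (+-multiple (fromℚ 1/3 * r) √3-squared)) (≃-trans (expand p q r √3)
      (≃-trans (+-cong (+-cong (*-cong ≃-refl at-ω) (*-cong ≃-refl p≃1)) (*-cong ≃-refl q≃0)) (evaluate √3)))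
      where
      expand : ∀ p q r s → r + fromℚ 1/3 * r * (s * s + - fromℕ 3)
        ≃ fromℚ 4/3 * (fromℚ 1/4 * (p + - (q * s) + r * (s * s))) + - fromℚ 1/3 * p + fromℚ 1/3 * s * q
      expand = solve 4 (λ p q r s → r :+ con 1/3 :* r :* (s :* s :+ :- con (+ 3 ℚ./ 1))
        := con 4/3 :* (con 1/4 :* (p :+ :- (q :* s) :+ r :* (s :* s))) :+ :- con 1/3 :* p :+ con 1/3 :* s :* q) ≃-refl
        where open ℝ-Solver
      evaluate : ∀ s → fromℚ 4/3 * 1ℝ + - fromℚ 1/3 * 1ℝ + fromℚ 1/3 * s * 0ℝ ≃ 1ℝ
      evaluate = solve 1 (λ s → con 4/3 :* con 1ℚ :+ :- con 1/3 :* con 1ℚ :+ con 1/3 :* s :* con 0ℚ := con 1ℚ) ≃-refl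
        where open ℝ-Solver

  -- The perfect pair built from a primitive vector of norm above 1.

  module Construction (x y : ℤ²) (det≡1 : det x y ≡ + 1) (1<norm : + 1 ℤ.< norm x)
    (l : ℕ) (4norm²<3ℓ² : + 4 ℤ.* (norm x ℤ.* norm x) ℤ.< + 3 ℤ.* (+ ℕ.suc l ℤ.* + ℕ.suc l)) where

    -- A successor by definition, so that division by `ℓ` is available and `1/1+ l` is its inverse.
    ℓ : ℕ
    ℓ = ℕ.suc l

    y′ : ℤ²
    y′ = + ℓ *ₗ y

    L M S S′ : Subset
    L = ℤ-span 1ᵛ ω
    M = ℤ-span (φ x) (φ y′)
    S = Pairs unit
    S′ = Pairs {1} (λ _ → x)

    ∈M⁻ : ∀ {v} → v ∈ M → ∃₂ λ p q → v ≈ φ (combine p q x y′)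
    ∈M⁻ (p , q , v≈) = p , q , ≈-trans v≈ (φ-combine p q x y′)

    ∈M⁺ : ∀ {v} p q {z} → v ≈ φ z → combine p q x y′ ≡ z → v ∈ M
    ∈M⁺ p q v≈ refl = p , q , ≈-trans v≈ (≈-sym (φ-combine p q x y′))

    M⊆L : ∀ {v} → v ∈ M → v ∈ L
    M⊆L v∈M = let p , q , v≈ = ∈M⁻ v∈M in proj₁ (combine p q x y′) , proj₂ (combine p q x y′) , v≈

    M-basis : IsBasis (φ x) (φ y′)
    M-basis = basis-change (fromℤ (proj₁ x)) (fromℤ (proj₂ x)) (fromℤ (proj₁ y′)) (fromℤ (proj₂ y′)) (fromℚ (1/1+ l)) (begin
      fromℚ (1/1+ l) * (fromℤ (proj₁ x) * fromℤ (proj₂ y′) + - (fromℤ (proj₂ x) * fromℤ (proj₁ y′)))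
        ≈⟨ *-cong ≃-refl (+-cong (fromℤ-* (proj₁ x) (proj₂ y′)) (-‿cong (fromℤ-* (proj₂ x) (proj₁ y′)))) ⟨
      fromℚ (1/1+ l) * (fromℤ (proj₁ x ℤ.* proj₂ y′) + - fromℤ (proj₂ x ℤ.* proj₁ y′))
        ≈⟨ *-cong ≃-refl (fromℤ-difference (proj₁ x ℤ.* proj₂ y′) (proj₂ x ℤ.* proj₁ y′)) ⟨
      fromℚ (1/1+ l) * fromℤ (det x y′)
        ≡⟨ cong (λ k → fromℚ (1/1+ l) * fromℤ k) (det-scaled x y det≡1 (+ ℓ)) ⟩
      fromℚ (1/1+ l) * fromℕ ℓ
        ≈⟨ pointwise (λ _ → trans (ℚ.*-comm (1/1+ l) ((+ ℓ) ℚ./ 1)) (1+*1/1+ l)) ⟩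
      1ℝ ∎)
      where open import Relation.Binary.Reasoning.Setoid ℝ-setoid

    -- Membership in `M` restricts only the `y`-coordinate, so the coset of `z` is `det x z` modulo
    -- `ℓ`, and the multiples `i y` with `0 ≤ i < ℓ` represent all cosets.
    index : HasIndex L M ℓ
    index = record
      { rep         = rep
      ; rep∈L       = λ i → + toℕ i ℤ.* proj₁ y , + toℕ i ℤ.* proj₂ y , ≈-refl
      ; complete    = complete
      ; irredundant = irredundant
      }
      where
      rep : Fin ℓ → ℝ²
      rep i = φ (+ toℕ i *ₗ y)
      complete : ∀ v → v ∈ L → ∃ λ i → v -ᵛ rep i ∈ M
      complete v (m , n , v≈) = i , ∈M⁺ (det z y) k (≈-trans (+ᵛ-cong v≈ ≈-refl) (φ-⊟ z (+ toℕ i *ₗ y))) (begin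
          combine (det z y) k x y′                                                     ≡⟨ combine-remainder (det z y) (+ toℕ i) k (+ ℓ) x y ⟨
          combine (det z y) (+ toℕ i ℤ.+ k ℤ.* + ℓ) x y ⊟ + toℕ i *ₗ y                 ≡⟨ cong (λ r → combine (det z y) (+ r ℤ.+ k ℤ.* + ℓ) x y ⊟ + toℕ i *ₗ y) (Fin.toℕ-fromℕ< (ℤ.n%ℕd<d (det x z) ℓ)) ⟩
          combine (det z y) (+ (det x z ℤ.%ℕ ℓ) ℤ.+ k ℤ.* + ℓ) x y ⊟ + toℕ i *ₗ y      ≡⟨ cong (λ q → combine (det z y) q x y ⊟ + toℕ i *ₗ y) (ℤ.a≡a%ℕn+[a/ℕn]*n (det x z) ℓ) ⟨
          combine (det z y) (det x z) x y ⊟ + toℕ i *ₗ y                               ≡⟨ cong (_⊟ + toℕ i *ₗ y) (coordinates x y det≡1 z) ⟩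
          z ⊟ + toℕ i *ₗ y                                                             ∎)
        where
        open ≡-Reasoning
        z : ℤ²
        z = m , n
        k : ℤ
        k = det x z ℤ./ℕ ℓ
        i : Fin ℓ
        i = fromℕ< (ℤ.n%ℕd<d (det x z) ℓ)
      irredundant : ∀ i j → rep i -ᵛ rep j ∈ M → i ≡ j
      irredundant i j difference∈M = let p , k , difference≈ = ∈M⁻ difference∈M in
        Fin.toℕ-injective (multiple-between k (Fin.toℕ<n i) (Fin.toℕ<n j)
          (trans (sym (det-difference x y det≡1 (+ toℕ i) (+ toℕ j)))
            (trans (cong (det x) (φ-injective (+ toℕ i *ₗ y ⊟ + toℕ j *ₗ y) (combine p k x y′)
                     (≈-trans (≈-sym (φ-⊟ (+ toℕ i *ₗ y) (+ toℕ j *ₗ y))) difference≈)))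
              (det-combine-scaled x y det≡1 p k (+ ℓ)))))

    -- A nonzero vector of `M` has norm at least `norm x`, which exceeds 1.
    small∉M : ∀ z → norm z ≡ + 1 → φ z ∉ M
    small∉M z norm≡1 z∈M = let p , q , z≈ = ∈M⁻ z∈M in
      contradict (φ-injective z (combine p q x y′) z≈) (sublattice-minimum x y det≡1 1<norm ℓ 4norm²<3ℓ² p q)
      where
      contradict : ∀ {w} → z ≡ w → ¬ ((w ≡ (+ 0 , + 0) ⊎ w ≡ x ⊎ w ≡ ⊖ x) ⊎ norm x ℤ.< norm w)
      contradict refl (inj₁ (inj₁ refl))     = contradiction norm≡1 λ ()
      contradict refl (inj₁ (inj₂ z≡±x))     = ℤ.<-irrefl (sym (trans (sym (norm-± z≡±x)) norm≡1)) 1<norm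
      contradict refl (inj₂ norm-x<norm-z)   = ℤ.<-irrefl (sym norm≡1) (ℤ.<-trans 1<norm norm-x<norm-z)

    isPerfect : IsPerfectFor (scale 1ℝ L) (scale 1ℝ M) S S′ (fromℤ (norm x))
    isPerfect = record
      { S-ext       = Pairs-ext unit
      ; S⊆L-M       = S⊆L-M
      ; S-nonempty  = φ (unit zero) , zero , inj₁ ≈-refl
      ; S′-ext      = Pairs-ext {1} (λ _ → x)
      ; S′⊆M-0      = S′⊆M-0
      ; S′-nonempty = φ x , zero , inj₁ ≈-refl
      ; conditions  = record
        { on-S   = A-Pairs unit norm-unit
        ; off-S  = off-S
        ; 1≤u    = fromℤ-mono-≤ (ℤ.<⇒≤ 1<norm)
        ; on-S′  = A-Pairs {1} (λ _ → x) (λ _ → refl)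
        ; off-S′ = off-S′
        }
      ; perfect     = λ B u′ _ conditions →
          let open Conditions conditions
              B≃A = units-determine-form B (λ i → on-S (φ (unit i)) (i , inj₁ ≈-refl))
          -- Once `B` agrees with `A`, both common values are read off at `x`, a member of `S′`.
          in B≃A , ≃-trans (≃-sym (on-S′ (φ x) (zero , inj₁ ≈-refl))) (≃-trans (B≃A (φ x)) (A-φ x))
      }
      where
      unscale-L : ∀ {v} → v ∈ scale 1ℝ L → v ∈ L
      unscale-L = scale-1⁻ (ℤ-span-ext 1ᵛ ω)
      M-ext : Extensional M
      M-ext = ℤ-span-ext (φ x) (φ y′)
      unscale-M : ∀ {v} → v ∈ scale 1ℝ M → v ∈ M
      unscale-M = scale-1⁻ M-ext
      S⊆L-M : ∀ v → v ∈ S → v ∈ scale 1ℝ L × v ∉ scale 1ℝ M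
      S⊆L-M v v∈S = let i , z , v≈ , z≡ = Pairs⁻ unit v∈S in
          scale-1⁺ (proj₁ z , proj₂ z , v≈)
        , λ v∈M → small∉M z (trans (norm-± z≡) (norm-unit i)) (M-ext v≈ (unscale-M v∈M))
      S′⊆M-0 : ∀ v → v ∈ S′ → v ∈ scale 1ℝ M × ¬ (v ≈ 0ᵛ)
      S′⊆M-0 v v∈S′ = let i , z , v≈ , z≡ = Pairs⁻ {1} (λ _ → x) v∈S′ in
          scale-1⁺ (±x∈M z≡ v≈)
        , λ v≈0 → nonzero (trans (sym (norm-± z≡)) (cong norm (φ-injective z (+ 0 , + 0) (≈-trans (≈-sym v≈) (≈-trans v≈0 (≈-sym φ-0))))))
        where
        ±x∈M : ∀ {v z} → z ≡ x ⊎ z ≡ ⊖ x → v ≈ φ z → v ∈ M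
        ±x∈M (inj₁ refl) v≈ = ∈M⁺ (+ 1) (+ 0) v≈ (combine-plus x y′)
        ±x∈M (inj₂ refl) v≈ = ∈M⁺ (ℤ.- + 1) (+ 0) v≈ (combine-minus x y′)
        nonzero : norm x ≢ + 0
        nonzero norm≡0 = ℤ.<-irrefl (sym norm≡0) (ℤ.<-trans (ℤ.+<+ (ℕ.s≤s ℕ.z≤n)) 1<norm)
      off-S : ∀ v → v ∈ scale 1ℝ L → v ∉ scale 1ℝ M → v ∉ S → 1ℝ < A v
      off-S v v∈L v∉M v∉S = let m , n , v≈ = unscale-L v∈L in
        <-resp-≃ ≃-refl (≃-sym (≃-trans (A-cong v≈) (A-φ (m , n))))
          -- The premises `v ∉ M` and `v ∉ S` can only refute. Refuting `norm ≤ 1` is enough because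
          -- the order of ℤ is decidable, and the resulting integer inequality supplies the real
          -- gap. The zero vector falls under `v ∉ M`.
          (fromℤ-mono-< (ℤ.≰⇒> λ small → short v≈ (norm≤1 (m , n) small)))
        where
        short : ∀ {z} → v ≈ φ z → ¬ (z ≡ (+ 0 , + 0) ⊎ ∃ λ i → z ≡ unit i ⊎ z ≡ ⊖ unit i)
        short v≈ (inj₁ refl)     = v∉M (scale-1⁺ (∈M⁺ (+ 0) (+ 0) v≈ (combine-zero x y′)))
        short v≈ (inj₂ (i , z≡)) = v∉S (Pairs⁺ unit i v≈ z≡)
      off-S′ : ∀ v → v ∈ scale 1ℝ M → ¬ (v ≈ 0ᵛ) → v ∉ S′ → fromℤ (norm x) < A v
      off-S′ v v∈M v≉0 v∉S′ = let p , q , v≈ = ∈M⁻ (unscale-M v∈M) in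
        <-resp-≃ ≃-refl (≃-sym (≃-trans (A-cong v≈) (A-φ (combine p q x y′))))
          (fromℤ-mono-< (long v≈ (sublattice-minimum x y det≡1 1<norm ℓ 4norm²<3ℓ² p q)))
        where
        long : ∀ {z} → v ≈ φ z → (z ≡ (+ 0 , + 0) ⊎ z ≡ x ⊎ z ≡ ⊖ x) ⊎ norm x ℤ.< norm z → norm x ℤ.< norm z
        long v≈ (inj₁ (inj₁ refl)) = contradiction (≈-trans v≈ φ-0) v≉0
        long v≈ (inj₁ (inj₂ z≡±x)) = contradiction (Pairs⁺ (λ _ → x) zero v≈ z≡±x) v∉S′
        long v≈ (inj₂ norm<)       = norm<

    temperedPerfect : TemperedPerfect ℓ L M
    temperedPerfect = record
      { L-lattice = 1ᵛ , ω , 1-ω-basis , λ _ → mk⇔ id id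
      ; M-lattice = φ x , φ y′ , M-basis , λ _ → mk⇔ id id
      ; M⊆L       = M⊆L
      ; index     = index
      ; c         = 1ℝ
      ; 0<c       = fromℤ-mono-< {+ 0} {+ 1} (ℤ.+<+ (ℕ.s≤s ℕ.z≤n))
      ; S         = S
      ; S′        = S′
      ; u         = fromℤ (norm x)
      ; isPerfect = isPerfect
      }

    three-and-one : (3 -and- 1) temperedPerfect
    three-and-one = consistsOfPairs unit unit-distinct , consistsOfPairs (λ _ → x) λ { zero zero _ → refl }

  -- Squaring, allowed since `β` is nonnegative, turns the bound into `β² < ¾ℓ²`. Both sides are now
  -- rational, so the inequality descends from ℝ to ℚ and, multiplied by 4, to ℤ.
  integral-bound : ∀ β ℓ → + 0 ℤ.≤ β → fromℤ β < fromℚ ½ * √3 * fromℕ ℓ → + 4 ℤ.* (β ℤ.* β) ℤ.< + 3 ℤ.* (+ ℓ ℤ.* + ℓ)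
  integral-bound β ℓ 0≤β β<½√3ℓ = fromℤ-cancel-< (fromℚ-mono-< (subst₂ ℚ._<_ lower upper
      (ℚ.*-monoʳ-<-pos (ι (+ 4)) (fromℚ-cancel-< (<-resp-≃ ≃-refl square (fromℚ-square-< (/1-mono-≤ 0≤β) β<½√3ℓ))))))
    where
    ι : ℤ → ℚ
    ι m = m ℚ./ 1
    square : fromℚ ½ * √3 * fromℕ ℓ * (fromℚ ½ * √3 * fromℕ ℓ) ≃ fromℚ (1/4 ℚ.* ι (+ 3) ℚ.* (ι (+ ℓ) ℚ.* ι (+ ℓ)))
    square = ≃-trans (expand √3 (fromℕ ℓ)) (≃-trans (+-multiple (fromℚ 1/4 * (fromℕ ℓ * fromℕ ℓ)) √3-squared) (pointwise λ _ → refl))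
      where
      expand : ∀ s k → fromℚ ½ * s * k * (fromℚ ½ * s * k) ≃ fromℚ 1/4 * fromℕ 3 * (k * k) + fromℚ 1/4 * (k * k) * (s * s + - fromℕ 3)
      expand = solve 2 (λ s k → con ½ :* s :* k :* (con ½ :* s :* k) := con 1/4 :* con (+ 3 ℚ./ 1) :* (k :* k) :+ con 1/4 :* (k :* k) :* (s :* s :+ :- con (+ 3 ℚ./ 1))) ≃-refl
        where open ℝ-Solver
    lower : ι (+ 4) ℚ.* (ι β ℚ.* ι β) ≡ ι (+ 4 ℤ.* (β ℤ.* β))
    lower = sym (trans (/1-* (+ 4) (β ℤ.* β)) (cong (ι (+ 4) ℚ.*_) (/1-* β β)))
    upper : ι (+ 4) ℚ.* (1/4 ℚ.* ι (+ 3) ℚ.* (ι (+ ℓ) ℚ.* ι (+ ℓ))) ≡ ι (+ 3 ℤ.* (+ ℓ ℤ.* + ℓ))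
    upper = trans (expand (ι (+ ℓ))) (sym (trans (/1-* (+ 3) (+ ℓ ℤ.* + ℓ)) (cong (ι (+ 3) ℚ.*_) (/1-* (+ ℓ) (+ ℓ)))))
      where
      expand : ∀ k → (+ 4 ℚ./ 1) ℚ.* (1/4 ℚ.* (+ 3 ℚ./ 1) ℚ.* (k ℚ.* k)) ≡ (+ 3 ℚ./ 1) ℚ.* (k ℚ.* k)
      expand = solve 1 (λ k → con (+ 4 ℚ./ 1) :* (con 1/4 :* con (+ 3 ℚ./ 1) :* (k :* k)) := con (+ 3 ℚ./ 1) :* (k :* k)) refl
        where open +-*-Solver

theorem1 : (ℓ : ℕ) → Prime ℓ →
    (√3 : ℝ) → IsSqrt √3 (fromℕ 3) →
    (β : ℤ) → β ≢ + 1 → PrimitivelyRepresented β →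
    fromℤ β < fromℚ ½ * √3 * fromℕ ℓ →
    Σ Subset λ L → Σ Subset λ M → Σ (TemperedPerfect ℓ L M) λ T →
    (3 -and- 1) T × ∃ λ τ → IsTemperament T τ × τ * τ ≃ fromℤ β
theorem1 ℕ.zero ℓ-prime = contradiction ℓ-prime ¬prime[0]
theorem1 (ℕ.suc l) _ √3 (_ , √3-squared) _ β≢1 (a , b , gcd≡1 , refl) β<½√3ℓ =
  L , M , temperedPerfect , three-and-one , τ , τ-sqrt , proj₂ τ-sqrt
  where
  x : ℤ²
  x = a , b
  y : ℤ²
  y = proj₁ (bézout x gcd≡1)
  det≡1 : det x y ≡ + 1
  det≡1 = proj₂ (bézout x gcd≡1)
  1<norm : + 1 ℤ.< norm x
  -- Here `β ≢ 1` enters: it keeps `x` from being a unit, so that all three pairs of units stay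
  -- outside `M`.
  1<norm = det≡1⇒1<norm x y det≡1 β≢1
  0≤norm : + 0 ℤ.≤ norm x
  0≤norm = ℤ.≤-trans (ℤ.+≤+ ℕ.z≤n) (ℤ.<⇒≤ 1<norm)
  open Hexagonal √3 √3-squared
  open Construction x y det≡1 1<norm l (integral-bound (norm x) (ℕ.suc l) 0≤norm β<½√3ℓ)
  norm-sqrt : ∃ λ s → IsSqrt s (fromℤ (norm x))
  norm-sqrt = subst (λ k → ∃ λ s → IsSqrt s (fromℤ k)) (ℤ.0≤i⇒+∣i∣≡i 0≤norm) (sqrt-ℕ ℤ.∣ norm x ∣)
  τ : ℝ
  τ = proj₁ norm-sqrt
  τ-sqrt : IsSqrt τ (fromℤ (norm x))
  τ-sqrt = proj₂ norm-sqrt
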